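{- There is a polynomial-time algorithm with oracle access to a decision oracle for LCE which, on input two linearly equivalent $[n,k,d]_q$ codes $\mathcal{C}_1,\mathcal{C}_2$ (given by generator matrices), outputs a permutation $\pi\in\mathcal{S}_n$ such that there exists $v\in(\mathbb{F}_q^{*})^n$ for which the linear isometry $\tau=(\pi,v)$ satisfies $\tau(\mathcal{C}_1)=\mathcal{C}_2$. The algorithm makes at most $n^2$ calls to the LCE oracle, and each call is on a pair of codes over $\mathbb{F}_q$ of dimension $k$ and length at most $n^2(n+1)/2$.
   Context: $\mathbb{F}_q$ is the finite field with $q$ elements. An $[n,k,d]_q$ code is a $k$-dimensional $\mathbb{F}_q$-subspace of $\mathbb{F}_q^n$ whose minimum nonzero Hamming weight is $d$; $n$ is its length and $k$ its dimension. A generator matrix of such a code is a matrix in $\mathbb{F}_q^{k\times n}$ whose rows span the code. $\mathcal{S}_n$ is the group of permutations of $\{1,\dots,n\}$. A linear isometry of $\mathbb{F}_q^n$ is a pair $\tau=(\sigma,v)\in\mathcal{S}_n\rtimes(\mathbb{F}_q^*)^n$ acting by $\tau(x)=y$ with $y_{\sigma(i)}=v_{\sigma(i)}x_i$ for all $i$. LCE (Linear Code Equivalence, decision problem): given two $[n,k,d]_q$ codes $\mathcal{C}_1,\mathcal{C}_2$ by generator matrices $G_1,G_2$, decide whether there is a linear isometry $\tau$ with $\mathcal{C}_2=\tau(\mathcal{C}_1)$; equivalently whether there are $S\in\mathrm{GL}_k(\mathbb{F}_q)$, an $n\times n$ permutation matrix $P$ and an $n\times n$ diagonal matrix $D$ with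 nonzero diagonal entries such that $G_2=SG_1PD$. Two codes for which the answer is positive are called linearly equivalent. Polynomial time means polynomial in the size of the input, each oracle call counting as one step. -}

module Defs where

open import Algebra.Bundles using (CommutativeRing)
import Algebra.Definitions.RawMonoid as RawMonoidDefinitions
open import Data.Bool.Base using (Bool; true; false)
open import Data.Fin.Base using (Fin; toℕ)
open import Data.Fin.Permutation using (Permutation′; _⟨$⟩ʳ_)
import Data.Fin.Properties as Fin
open import Data.List.Base using (List; []; _∷_; _++_; allFin; filter; length)
open import Data.Nat.Base using (ℕ; zero; suc; _+_; _^_; _≤_)
open import Data.Nat.Logarithm using (⌈log₂_⌉)
open import Data.Product.Base using (∃-syntax; Σ-syntax; _×_; _,_; proj₁)
open import Data.Vec.Base using (Vec; lookup)
  renaming ([] to []ᵛ; _∷_ to _∷ᵛ_)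
open import Data.Vec.Functional using (Vector; foldr; map)
open import Function.Bundles using (Inverse)
import Function.Properties.Inverse as Inverse
open import Level using (0ℓ)
open import Relation.Binary.Definitions using (Decidable)
open import Relation.Binary.PropositionalEquality using (_≡_; _≢_)
import Relation.Binary.PropositionalEquality as ≡
open import Relation.Nullary using (yes; no; does)
open import Relation.Nullary.Decidable using (¬?; via-injection)
open import Relation.Nullary.Reflects using (Reflects)
open import Relation.Unary using (Pred; _≐_)

record FiniteField : Set₁ where
  field
    commutativeRing : CommutativeRing 0ℓ 0ℓ

  open CommutativeRing commutativeRing public
    renaming (_+_ to _+ᶠ_; _*_ to _*ᶠ_; -_ to -ᶠ_)
    using (Carrier; _≈_; _≉_; 0#; 1#; setoid; +-rawMonoid)

  field
    1≉0         : 1# ≉ 0#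
    invertible  : ∀ x → x ≉ 0# → ∃[ y ] x *ᶠ y ≈ 1#
    q           : ℕ
    enumeration : Inverse setoid (≡.setoid (Fin q))

  infix 4 _≟_
  _≟_ : Decidable _≈_
  _≟_ = via-injection (Inverse.Inverse⇒Injection enumeration) Fin._≟_

module Codes (F : FiniteField) where
  open FiniteField F
  open RawMonoidDefinitions +-rawMonoid using (sum)

  F* : Set
  F* = ∃[ x ] x ≉ 0#

  Word : ℕ → Set
  Word n = Vector Carrier n

  Matrix : ℕ → ℕ → Set
  Matrix k n = Vector (Word n) k

  combination : ∀ {k n} → Word k → Matrix k n → Word n
  combination a G j = sum λ i → a i *ᶠ G i j

  Code : ℕ → Set₁
  Code n = Pred (Word n) 0ℓ

  ⟨_⟩ : ∀ {k n} → Matrix k n → Code n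
  ⟨ G ⟩ x = ∃[ a ] (∀ j → x j ≈ combination a G j)

  LinearlyIndependent : ∀ {k n} → Matrix k n → Set
  LinearlyIndependent G =
    ∀ a → (∀ j → combination a G j ≈ 0#) → ∀ i → a i ≈ 0#

  -- Having a basis of k vectors also makes C a subspace.
  HasDimension : ∀ {n} → ℕ → Code n → Set
  HasDimension {n} k C = Σ[ B ∈ Matrix k n ] LinearlyIndependent B × C ≐ ⟨ B ⟩

  weight : ∀ {n} → Word n → ℕ
  weight {n} x = length (filter (λ i → ¬? (x i ≟ 0#)) (allFin n))

  HasMinimumWeight : ∀ {n} → ℕ → Code n → Set
  HasMinimumWeight d C =
    (∃[ x ] C x × Nonzero x × weight x ≡ d) ×
    (∀ x → C x → Nonzero x → d ≤ weight x)
    where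
    Nonzero : ∀ {n} → Word n → Set
    Nonzero x = ∃[ i ] x i ≉ 0#

  Is[_,_,_]Code : ∀ n → ℕ → ℕ → Code n → Set
  Is[ n , k , d ]Code C = HasDimension k C × HasMinimumWeight d C

  LinearIsometry : ℕ → Set
  LinearIsometry n = Permutation′ n × Vector F* n

  _maps_to_ : ∀ {n} → LinearIsometry n → Word n → Word n → Set
  (σ , v) maps x to y = ∀ i → y (σ ⟨$⟩ʳ i) ≈ proj₁ (v (σ ⟨$⟩ʳ i)) *ᶠ x i

  image : ∀ {n} → LinearIsometry n → Code n → Code n
  image τ C y = ∃[ x ] C x × τ maps x to y

  LinearlyEquivalent : ∀ {n} → Code n → Code n → Set
  LinearlyEquivalent C₁ C₂ = ∃[ τ ] image τ C₁ ≐ C₂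

-- A first-order version of Jones's WHILE language: the values are binary
-- trees, and while loops are the only source of unboundedness.  Leaves may
-- also hold elements of the field, on which a program acts only through the
-- field operations and equality.  The syntax does not depend on the field,
-- so a program is a single algorithm for all finite fields.

data Constant : Set where
  nil zero one : Constant

data Unary : Set where
  head tail neg inv : Unary

data Binary : Set where
  cons add mul equal : Binary

-- Term n has n free variables, the most recently bound one having index 0.
data Term (n : ℕ) : Set where
  var           : Fin n → Term n
  const         : Constant → Term n
  unary         : Unary → Term n → Term n
  binary        : Binary → Term n → Term n → Term n
  let′          : Term n → Term (suc n) → Term n
  if_then_else_ : Term n → Term n → Term n → Term n
  -- from s while b step t:  x := s; while b(x) do x := t(x); return x
  from_while_step_ : Term n → Term (suc n) → Term (suc n) → Term n
  ask           : Term n → Term n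

-- The free variable is the input.
Program : Set
Program = Term 1

module Semantics (F : FiniteField) where
  open FiniteField F
  open Codes F public

  infixr 5 _∙_
  data Tree : Set where
    nil  : Tree
    atom : Carrier → Tree
    _∙_  : Tree → Tree → Tree

  bool : Bool → Tree
  bool false = nil
  bool true  = nil ∙ nil

  ⟦_⟧₀ : Constant → Tree
  ⟦ nil  ⟧₀ = nil
  ⟦ zero ⟧₀ = atom 0#
  ⟦ one  ⟧₀ = atom 1#

  -- Operations applied outside their domain return nil.
  ⟦_⟧₁ : Unary → Tree → Tree
  ⟦ head ⟧₁ (t ∙ _)  = t
  ⟦ tail ⟧₁ (_ ∙ u)  = u
  ⟦ neg  ⟧₁ (atom x) = atom (-ᶠ x)
  ⟦ inv  ⟧₁ (atom x) with x ≟ 0#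
  ... | yes _  = nil
  ... | no x≉0 = atom (proj₁ (invertible x x≉0))
  ⟦ _    ⟧₁ _        = nil

  ⟦_⟧₂ : Binary → Tree → Tree → Tree
  ⟦ cons  ⟧₂ t        u        = t ∙ u
  ⟦ add   ⟧₂ (atom x) (atom y) = atom (x +ᶠ y)
  ⟦ mul   ⟧₂ (atom x) (atom y) = atom (x *ᶠ y)
  ⟦ equal ⟧₂ (atom x) (atom y) = bool (does (x ≟ y))
  ⟦ _     ⟧₂ _        _        = nil

  -- A field element occupies ⌈log₂ q⌉ bits.
  bits : ℕ
  bits = ⌈log₂ q ⌉

  size : Tree → ℕ
  size nil      = 1
  size (atom _) = bits
  size (t ∙ u)  = 1 + size t + size u

  -- Trees are handled by reference, with sharing, so a tree operation takes
  -- one step and a run of c steps creates at most c nodes.  The field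
  -- operations are charged at the quadratic schoolbook rate.
  cost₀ : Constant → ℕ
  cost₀ nil  = 1
  cost₀ zero = bits
  cost₀ one  = bits

  cost₁ : Unary → ℕ
  cost₁ head = 1
  cost₁ tail = 1
  cost₁ neg  = bits ^ 2
  cost₁ inv  = bits ^ 2

  cost₂ : Binary → ℕ
  cost₂ cons  = 1
  cost₂ add   = bits ^ 2
  cost₂ mul   = bits ^ 2
  cost₂ equal = bits ^ 2

  Oracle : Set
  Oracle = Tree → Bool

  Environment : ℕ → Set
  Environment n = Vec Tree n

  module Evaluation (O : Oracle) where

    -- ρ ⊢ s ⇓ t ∣ c , Q :  in the environment ρ, s evaluates to t in c steps,
    -- Q being the list of queries made to the oracle, in order.
    infix 4 _⊢_⇓_∣_,_ _⊢while_step_from_⇓_∣_,_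

    data _⊢_⇓_∣_,_ {n} (ρ : Environment n) :
           Term n → Tree → ℕ → List Tree → Set

    data _⊢while_step_from_⇓_∣_,_ {n} (ρ : Environment n)
           (s₁ s₂ : Term (suc n)) : Tree → Tree → ℕ → List Tree → Set

    data _⊢_⇓_∣_,_ {n} ρ where

      var : ∀ i → ρ ⊢ var i ⇓ lookup ρ i ∣ 1 , []

      const : ∀ o → ρ ⊢ const o ⇓ ⟦ o ⟧₀ ∣ cost₀ o , []

      unary : ∀ o {s t c Q} →
        ρ ⊢ s ⇓ t ∣ c , Q →
        ρ ⊢ unary o s ⇓ ⟦ o ⟧₁ t ∣ cost₁ o + c , Q

      binary : ∀ o {s₁ s₂ t₁ t₂ c₁ c₂ Q₁ Q₂} →
        ρ ⊢ s₁ ⇓ t₁ ∣ c₁ , Q₁ →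
        ρ ⊢ s₂ ⇓ t₂ ∣ c₂ , Q₂ →
        ρ ⊢ binary o s₁ s₂ ⇓ ⟦ o ⟧₂ t₁ t₂ ∣ cost₂ o + c₁ + c₂ , Q₁ ++ Q₂

      let′ : ∀ {s₁ s₂ t₁ t₂ c₁ c₂ Q₁ Q₂} →
        ρ ⊢ s₁ ⇓ t₁ ∣ c₁ , Q₁ →
        t₁ ∷ᵛ ρ ⊢ s₂ ⇓ t₂ ∣ c₂ , Q₂ →
        ρ ⊢ let′ s₁ s₂ ⇓ t₂ ∣ 1 + c₁ + c₂ , Q₁ ++ Q₂

      if-true : ∀ {s s₁ s₂ t t₁ c c₁ Q Q₁} →
        ρ ⊢ s ⇓ t ∣ c , Q → t ≢ nil →
        ρ ⊢ s₁ ⇓ t₁ ∣ c₁ , Q₁ →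
        ρ ⊢ if s then s₁ else s₂ ⇓ t₁ ∣ 1 + c + c₁ , Q ++ Q₁

      if-false : ∀ {s s₁ s₂ t₂ c c₂ Q Q₂} →
        ρ ⊢ s ⇓ nil ∣ c , Q →
        ρ ⊢ s₂ ⇓ t₂ ∣ c₂ , Q₂ →
        ρ ⊢ if s then s₁ else s₂ ⇓ t₂ ∣ 1 + c + c₂ , Q ++ Q₂

      loop : ∀ {s s₁ s₂ t u c c′ Q Q′} →
        ρ ⊢ s ⇓ t ∣ c , Q →
        ρ ⊢while s₁ step s₂ from t ⇓ u ∣ c′ , Q′ →
        ρ ⊢ from s while s₁ step s₂ ⇓ u ∣ 1 + c + c′ , Q ++ Q′

      ask : ∀ {s t c Q} →
        ρ ⊢ s ⇓ t ∣ c , Q →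
        ρ ⊢ ask s ⇓ bool (O t) ∣ 1 + c , Q ++ t ∷ []

    data _⊢while_step_from_⇓_∣_,_ {n} ρ s₁ s₂ where

      stop : ∀ {t c Q} →
        t ∷ᵛ ρ ⊢ s₁ ⇓ nil ∣ c , Q →
        ρ ⊢while s₁ step s₂ from t ⇓ t ∣ 1 + c , Q

      next : ∀ {t t₁ t₂ u c₁ c₂ c₃ Q₁ Q₂ Q₃} →
        t ∷ᵛ ρ ⊢ s₁ ⇓ t₁ ∣ c₁ , Q₁ → t₁ ≢ nil →
        t ∷ᵛ ρ ⊢ s₂ ⇓ t₂ ∣ c₂ , Q₂ →
        ρ ⊢while s₁ step s₂ from t₂ ⇓ u ∣ c₃ , Q₃ →
        ρ ⊢while s₁ step s₂ from t ⇓ u ∣ 1 + c₁ + c₂ + c₃ , Q₁ ++ Q₂ ++ Q₃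

    Runs : Program → Tree → Tree → ℕ → List Tree → Set
    Runs P input t c Q = input ∷ᵛ []ᵛ ⊢ P ⇓ t ∣ c , Q

  open Evaluation public using (Runs)

  list : ∀ {n} → Vector Tree n → Tree
  list = foldr _∙_ nil

  unaryNumeral : ℕ → Tree
  unaryNumeral zero    = nil
  unaryNumeral (suc m) = nil ∙ unaryNumeral m

  encodeMatrix : ∀ {k n} → Matrix k n → Tree
  encodeMatrix G = list (map (λ row → list (map atom row)) G)

  encodePair : ∀ {k n} → Matrix k n → Matrix k n → Tree
  encodePair G H = encodeMatrix G ∙ encodeMatrix H

  encodePermutation : ∀ {n} → Permutation′ n → Tree
  encodePermutation π = list λ i → unaryNumeral (toℕ (π ⟨$⟩ʳ i))

  -- The answer is unconstrained on trees that do not encode an instance.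
  -- Inequivalent codes may have distinct minimum weights.
  DecidesLCE : Oracle → Set
  DecidesLCE O = ∀ {k n} (G H : Matrix k n) →
    HasDimension k ⟨ G ⟩ → HasDimension k ⟨ H ⟩ →
    Reflects (LinearlyEquivalent ⟨ G ⟩ ⟨ H ⟩) (O (encodePair G H))

  IsLCEInstance : (k N : ℕ) → Tree → Set
  IsLCEInstance k N t = ∃[ m ] m ≤ N ×
    Σ[ G ∈ Matrix k m ] Σ[ H ∈ Matrix k m ]
      HasDimension k ⟨ G ⟩ × HasDimension k ⟨ H ⟩ × t ≡ encodePair G H

{-# OPTIONS --safe #-}
module Submission where

-- Columns of a generator matrix that are proportional form a class, and an
-- isometry is, up to the choice of images within the classes, a bijection of
-- classes that preserves their sizes.  Individualise columns by repetition:
-- give the labels 1, ..., m to pairs of columns from m distinct classes and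
-- add n·l copies of the columns labelled l to both codes.  The number of
-- columns in a class then determines both its size and its label, so the
-- extended codes are equivalent exactly if some isometry of the original
-- codes respects all labels.  Columns are assigned one after the other, from
-- the last: with the largest label on the column i and on a candidate j, the
-- oracle tells whether the assignment i ↦ j is compatible with the earlier
-- ones, and by counting within the class of i an unused candidate exists.
-- The label is kept only if i belongs to a new class, which is again decided
-- by such queries, of the first code with itself.  A stage makes at most one
-- query for each unused image and for each earlier label, n in all.

open import Defs
open import Algebra.Bundles using (CommutativeRing)
import Algebra.Properties.CommutativeSemigroup as CommutativeSemigroupProperties
import Algebra.Properties.Semiring.Sum as SemiringSum
open import Data.Bool.Base using (Bool; true; false)
open import Data.Empty using (⊥; ⊥-elim)
open import Data.Fin.Base using (Fin; zero; suc; toℕ; punchIn; _↑ʳ_)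
open import Data.Fin.Patterns using (0F; 1F; 2F; 3F; 4F; 5F; 6F; 7F)
open import Data.Fin.Permutation
  using (Permutation′; _⟨$⟩ʳ_; _⟨$⟩ˡ_; inverseˡ; inverseʳ; insert; insert-punchIn; lift₀)
import Data.Fin.Permutation as Permutation
import Data.Fin.Properties as Fin
open import Data.List.Base
  using (List; []; _∷_; _++_; _ʳ++_; length; map; foldr; foldl; replicate; tabulate; allFin; reverse)
open import Data.List.Membership.Propositional using (_∈_; find; lose)
open import Data.List.Properties
  using (length-++; length-map; length-replicate; length-reverse; length-tabulate; length-ʳ++;
         map-id; map-∘; map-++; map-replicate; map-tabulate; map-ʳ++; tabulate-cong;
         ʳ++-defn; reverse-map; reverse-involutive; ∷-injective)
open import Data.List.Relation.Binary.Permutation.Propositional using (_↭_; ↭-sym; ↭-trans; ↭-reflexive; prep)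
open import Data.List.Relation.Binary.Permutation.Propositional.Properties
  using (++⁺ˡ; ++↭ʳ++; ↭-length; ↭-reverse; shift; ∷↭∷ʳ; All-resp-↭)
  renaming (map⁺ to ↭-map⁺)
open import Data.List.Relation.Unary.All as All using (All; []; _∷_)
import Data.List.Relation.Unary.All.Properties as All
open import Data.List.Relation.Unary.AllPairs using (AllPairs; []; _∷_)
open import Data.List.Relation.Unary.Any as Any using (Any; here; there)
import Data.List.Relation.Unary.Any.Properties as Any
open import Data.Nat.Base using (ℕ; zero; suc; _+_; _*_; _^_; _/_; _%_; _⊔_; _≤_; _<_; z≤n; s≤s; >-nonZero)
open import Data.Nat.DivMod using ([m+kn]%n≡m%n; m<n⇒m%n≡m; m*n/n≡m; /-monoˡ-≤)
open import Data.Nat.Properties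
  using (≤-refl; ≤-trans; ≤-reflexive; <-trans; ≤-<-trans; <⇒≤; n<1+n; n≤1+n; m≤m+n; m≤n+m; m≤n⇒m≤1+n; m≤m*n;
         m≤m⊔n; m≤n⊔m; ⊔-monoʳ-≤; +-assoc; +-comm; +-identityʳ; +-suc; +-cancelˡ-≡; +-cancelʳ-≡; +-mono-≤;
         +-monoˡ-≤; +-monoʳ-≤; +-0-commutativeMonoid; *-assoc; *-comm; *-identityˡ; *-identityʳ; *-zeroʳ; *-suc;
         *-distribˡ-+; *-distribʳ-+; *-cancelʳ-≡; *-mono-≤; *-mono-<; *-monoˡ-≤; *-monoʳ-≤; suc-injective;
         ^-monoʳ-≤; ^-identityʳ; ^-distribˡ-+-*; m^n>0; module ≤-Reasoning)
open import Algebra.Properties.CommutativeMonoid.Sum +-0-commutativeMonoid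
  using () renaming (sum to ∑; sum-permute to ∑-permute)
open import Data.Product.Base using (_×_; _,_; Σ-syntax; ∃-syntax; proj₁; proj₂)
open import Data.Sum.Base as Sum using (_⊎_; inj₁; inj₂)
open import Data.Unit.Base using (⊤; tt)
open import Data.Vec.Base using (lookup) renaming ([] to []ᵛ; _∷_ to _∷ᵛ_)
open import Data.Vec.Functional using (Vector)
open import Function.Base using (_∘_; id)
open import Function.Bundles using (Inverse; mk⇔)
open import Level using (0ℓ)
open import Relation.Binary.Bundles using (DecSetoid; Setoid)
open import Relation.Binary.PropositionalEquality
  using (_≡_; _≢_; refl; sym; trans; cong; cong₂; subst; subst₂; module ≡-Reasoning)
import Relation.Binary.Reasoning.Setoid as SetoidReasoning
open import Relation.Nullary using (¬_; Dec; yes; no; does)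
open import Relation.Nullary.Decidable using (dec-true; dec-false; does-⇔; map′; ¬?; _×-dec_)
open import Relation.Nullary.Reflects using (Reflects; ofʸ; ofⁿ; invert)
open import Relation.Unary using (_≐_)

-- Counting

-- An isometry of the extended codes may exchange original columns with copies, so it does not
-- restrict to the original codes; what survives is a bijection of classes. A class with s columns
-- of its own and total label w has n·w + s columns after the extension, and 1 ≤ s ≤ n, so w and s -
-- 1 are the quotient and the remainder of one less than that number by n. A permutation of the
-- original columns is then chosen anew inside the classes. Hence the permutation that witnesses
-- compatibility may change from stage to stage. The output agrees with it only up to
-- proportionality, which is enough because the scalars of an isometry absorb the difference.
-- Proportionality could be tested by field arithmetic; testing it by queries keeps the program free
-- of field operations, so every step that it takes has unit cost, whatever the field.

indicator : Bool → ℕ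
indicator true  = 1
indicator false = 0

count : ∀ {A : Set} → (A → Bool) → List A → ℕ
count p []       = 0
count p (x ∷ xs) = indicator (p x) + count p xs

indicator≤1 : ∀ b → indicator b ≤ 1
indicator≤1 true  = ≤-refl
indicator≤1 false = z≤n

module _ {A : Set} where

  count-++ : ∀ (p : A → Bool) xs ys → count p (xs ++ ys) ≡ count p xs + count p ys
  count-++ p []       ys = refl
  count-++ p (x ∷ xs) ys =
    trans (cong (indicator (p x) +_) (count-++ p xs ys)) (sym (+-assoc (indicator (p x)) _ _))

  count-replicate : ∀ (p : A → Bool) n x → count p (replicate n x) ≡ n * indicator (p x)
  count-replicate p zero    x = refl
  count-replicate p (suc n) x = cong (indicator (p x) +_) (count-replicate p n x)

  count-≤-length : ∀ (p : A → Bool) xs → count p xs ≤ length xs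
  count-≤-length p []       = z≤n
  count-≤-length p (x ∷ xs) = +-mono-≤ (indicator≤1 (p x)) (count-≤-length p xs)

  count-↭ : ∀ (p : A → Bool) {xs ys} → xs ↭ ys → count p xs ≡ count p ys
  count-↭ p _↭_.refl         = refl
  count-↭ p (_↭_.prep x r)   = cong (indicator (p x) +_) (count-↭ p r)
  count-↭ p (_↭_.swap {xs} {ys} x y r) = begin
    indicator (p x) + (indicator (p y) + count p xs) ≡⟨ sym (+-assoc (indicator (p x)) _ _) ⟩
    indicator (p x) + indicator (p y) + count p xs
      ≡⟨ cong₂ _+_ (+-comm (indicator (p x)) _) (count-↭ p r) ⟩
    indicator (p y) + indicator (p x) + count p ys   ≡⟨ +-assoc (indicator (p y)) _ _ ⟩
    indicator (p y) + (indicator (p x) + count p ys) ∎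
    where open ≡-Reasoning
  count-↭ p (_↭_.trans r s)  = trans (count-↭ p r) (count-↭ p s)

  count-positive : ∀ (p : A → Bool) xs → 0 < count p xs → Any (λ x → p x ≡ true) xs
  count-positive p (x ∷ xs) 0<c with p x in eq
  ... | true  = here eq
  ... | false = there (count-positive p xs 0<c)

  count-tabulate : ∀ (p : A → Bool) {n} (f : Fin n → A) →
                   count p (tabulate f) ≡ ∑ (λ i → indicator (p (f i)))
  count-tabulate p {zero}  f = refl
  count-tabulate p {suc n} f = cong (indicator (p (f zero)) +_) (count-tabulate p (f ∘ suc))

  count-tabulate-permute : ∀ (p : A → Bool) {n} (f : Fin n → A) (σ : Permutation′ n) →
    count p (tabulate (f ∘ (σ ⟨$⟩ʳ_))) ≡ count p (tabulate f)
  count-tabulate-permute p f σ = begin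
    count p (tabulate (f ∘ (σ ⟨$⟩ʳ_)))          ≡⟨ count-tabulate p (f ∘ (σ ⟨$⟩ʳ_)) ⟩
    ∑ (λ i → indicator (p (f (σ ⟨$⟩ʳ i))))    ≡⟨ ∑-permute (λ i → indicator (p (f i))) σ ⟨
    ∑ (λ i → indicator (p (f i)))             ≡⟨ count-tabulate p f ⟨
    count p (tabulate f)                        ∎
    where open ≡-Reasoning

  count-tabulate-punchIn : ∀ (p : A → Bool) {n} (f : Fin (suc n) → A) i →
    count p (tabulate f) ≡ indicator (p (f i)) + count p (tabulate (f ∘ punchIn i))
  count-tabulate-punchIn p f zero = refl
  count-tabulate-punchIn p {suc n} f (suc i) = begin
    indicator (p (f zero)) + count p (tabulate (f ∘ suc))
      ≡⟨ cong (indicator (p (f zero)) +_) (count-tabulate-punchIn p (f ∘ suc) i) ⟩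
    indicator (p (f zero)) + (indicator (p (f (suc i))) + rest)
      ≡⟨ +-assoc (indicator (p (f zero))) _ _ ⟨
    indicator (p (f zero)) + indicator (p (f (suc i))) + rest
      ≡⟨ cong (_+ rest) (+-comm (indicator (p (f zero))) _) ⟩
    indicator (p (f (suc i))) + indicator (p (f zero)) + rest
      ≡⟨ +-assoc (indicator (p (f (suc i)))) _ _ ⟩
    indicator (p (f (suc i))) + (indicator (p (f zero)) + rest) ∎
    where open ≡-Reasoning
          rest = count p (tabulate (f ∘ suc ∘ punchIn i))

count-map : ∀ {A B : Set} (p : B → Bool) (f : A → B) xs → count p (map f xs) ≡ count (p ∘ f) xs
count-map p f []       = refl
count-map p f (x ∷ xs) = cong (indicator (p (f x)) +_) (count-map p f xs)

count-tabulate-cong : ∀ {A B : Set} (p : A → Bool) (q : B → Bool) {n} (f : Fin n → A) (g : Fin n → B) →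
  (∀ i → p (f i) ≡ q (g i)) → count p (tabulate f) ≡ count q (tabulate g)
count-tabulate-cong p q {zero}  f g h = refl
count-tabulate-cong p q {suc n} f g h =
  cong₂ _+_ (cong indicator (h zero)) (count-tabulate-cong p q (f ∘ suc) (g ∘ suc) (h ∘ suc))

any-tabulate : ∀ {A : Set} {P : A → Set} {n} (f : Fin n → A) → Any P (tabulate f) → ∃[ i ] P (f i)
any-tabulate {n = suc n} f (here px)  = zero , px
any-tabulate {n = suc n} f (there ps) with any-tabulate (f ∘ suc) ps
... | i , px = suc i , px

does-true : ∀ {P : Set} (p? : Dec P) → does p? ≡ true → P
does-true (yes p) _ = p

-- Bijections that respect an equivalence relation

module Matching (S : DecSetoid 0ℓ 0ℓ) where
  open DecSetoid S using (_≈_; _≟_) renaming (Carrier to X; refl to ~-refl; sym to ~-sym; trans to ~-trans)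

  _~ᵇ_ : X → X → Bool
  x ~ᵇ y = does (x ≟ y)

  ~ᵇ-refl : ∀ x → (x ~ᵇ x) ≡ true
  ~ᵇ-refl x = dec-true (x ≟ x) ~-refl

  ~ᵇ-congʳ : ∀ x {y z} → y ≈ z → (x ~ᵇ y) ≡ (x ~ᵇ z)
  ~ᵇ-congʳ x {y} {z} y~z =
    does-⇔ (mk⇔ (λ e → ~-trans e y~z) (λ e → ~-trans e (~-sym y~z))) (x ≟ y) (x ≟ z)

  ~ᵇ⇒~ : ∀ {x y} → (x ~ᵇ y) ≡ true → x ≈ y
  ~ᵇ⇒~ {x} {y} = does-true (x ≟ y)

  -- A greedy choice succeeds: within a class every partner is as good as any other, and removing a
  -- matched pair lowers both counts of its class by one.
  matching : ∀ {n} (f g : Fin n → X) →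
    (∀ x → count (x ~ᵇ_) (tabulate f) ≡ count (x ~ᵇ_) (tabulate g)) →
    Σ[ σ ∈ Permutation′ n ] (∀ i → f i ≈ g (σ ⟨$⟩ʳ i))
  matching {zero}  f g same = Permutation.id , λ ()
  matching {suc n} f g same = insert zero j σ , matches
    where
    present : 0 < count (f zero ~ᵇ_) (tabulate g)
    present = begin-strict
      0                                                       <⟨ s≤s z≤n ⟩
      indicator true + count (f zero ~ᵇ_) (tabulate (f ∘ suc)) ≡⟨ cong (λ b → indicator b + count (f zero ~ᵇ_) (tabulate (f ∘ suc))) (~ᵇ-refl (f zero)) ⟨
      count (f zero ~ᵇ_) (tabulate f)                         ≡⟨ same (f zero) ⟩
      count (f zero ~ᵇ_) (tabulate g)                         ∎
      where open ≤-Reasoning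

    found = any-tabulate g (count-positive (f zero ~ᵇ_) (tabulate g) present)
    j     = proj₁ found

    f₀~gⱼ : f zero ≈ g j
    f₀~gⱼ = ~ᵇ⇒~ (proj₂ found)

    same′ : ∀ x → count (x ~ᵇ_) (tabulate (f ∘ suc)) ≡ count (x ~ᵇ_) (tabulate (g ∘ punchIn j))
    same′ x = +-cancelˡ-≡ (indicator (x ~ᵇ f zero)) _ _ (begin
      count (x ~ᵇ_) (tabulate f)                                               ≡⟨ same x ⟩
      count (x ~ᵇ_) (tabulate g)                                               ≡⟨ count-tabulate-punchIn (x ~ᵇ_) g j ⟩
      indicator (x ~ᵇ g j) + count (x ~ᵇ_) (tabulate (g ∘ punchIn j))
        ≡⟨ cong (λ b → indicator b + count (x ~ᵇ_) (tabulate (g ∘ punchIn j))) (~ᵇ-congʳ x f₀~gⱼ) ⟨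
      indicator (x ~ᵇ f zero) + count (x ~ᵇ_) (tabulate (g ∘ punchIn j))       ∎)
      where open ≡-Reasoning

    rest = matching (f ∘ suc) (g ∘ punchIn j) same′
    σ    = proj₁ rest

    matches : ∀ i → f i ≈ g (insert zero j σ ⟨$⟩ʳ i)
    matches zero    = f₀~gⱼ
    matches (suc i) = subst (λ k → f (suc i) ≈ g k) (sym (insert-punchIn zero j σ i)) (proj₂ rest i)

count-positive⁺ : ∀ {A : Set} (p : A → Bool) x xs → p x ≡ true → 0 < count p (x ∷ xs)
count-positive⁺ p x xs px = subst (λ b → 0 < indicator b + count p xs) (sym px) (s≤s z≤n)

count-map-cong : ∀ {A B C : Set} {P : A → Set} (p : B → Bool) (q : C → Bool) (f : A → B) (g : A → C) →
  (∀ {x} → P x → p (f x) ≡ q (g x)) → ∀ {xs} → All P xs →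
  count p (map f xs) ≡ count q (map g xs)
count-map-cong p q f g same []        = refl
count-map-cong p q f g same (px ∷ ps) = cong₂ _+_ (cong indicator (same px)) (count-map-cong p q f g same ps)

-- At the end of the search this makes a function of the list of assignments, whose first components
-- then enumerate the columns in order.
functionTable : ∀ {A B : Set} {n} (g : Fin n → A) (zs : List (A × B)) → map proj₁ zs ≡ tabulate g →
  Σ[ f ∈ (Fin n → B) ] map proj₂ zs ≡ tabulate f × (∀ i → (g i , f i) ∈ zs)
functionTable {n = zero}  g []             _  = (λ ()) , refl , λ ()
functionTable {n = suc n} g ((a , b) ∷ zs) eq
  with refl , eq′ ← ∷-injective eq
  with f , images , members ← functionTable (g ∘ suc) zs eq′ =
  (λ { zero → b ; (suc i) → f i }) , cong (b ∷_) images , λ { zero → here refl ; (suc i) → there (members i) }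

-- Isometries and proportional columns

module CodeProperties (F : FiniteField) where
  open FiniteField F
  open Codes F
  open CommutativeRing commutativeRing
    using (semiring; *-commutativeSemigroup; *-cong; *-congˡ; *-congʳ;
           zeroˡ; zeroʳ; +-cong)
    renaming (reflexive to ≈-reflexive; refl to ≈-refl; sym to ≈-sym; trans to ≈-trans;
              *-assoc to *ᶠ-assoc; *-comm to *ᶠ-comm; *-identityˡ to *ᶠ-identityˡ;
              +-identityˡ to +ᶠ-identityˡ; +-identityʳ to +ᶠ-identityʳ)
  open SemiringSum semiring using (sum; sum-cong-≋; sum-replicate-zero; *-distribˡ-sum)
  open CommutativeSemigroupProperties *-commutativeSemigroup using (x∙yz≈y∙xz)
  open SetoidReasoning setoid

  *-nonzero : ∀ {x y} → x ≉ 0# → y ≉ 0# → x *ᶠ y ≉ 0#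
  *-nonzero {x} {y} x≉0 y≉0 xy≈0 with x⁻¹ , xx⁻¹≈1 ← invertible x x≉0 = y≉0 (begin
    y                ≈⟨ *ᶠ-identityˡ y ⟨
    1# *ᶠ y          ≈⟨ *-congʳ (≈-trans (*ᶠ-comm _ _) xx⁻¹≈1) ⟨
    (x⁻¹ *ᶠ x) *ᶠ y  ≈⟨ *ᶠ-assoc _ _ _ ⟩
    x⁻¹ *ᶠ (x *ᶠ y)  ≈⟨ *-congˡ xy≈0 ⟩
    x⁻¹ *ᶠ 0#        ≈⟨ zeroʳ _ ⟩
    0#               ∎)

  infix 8 _⁻¹
  _⁻¹ : F* → F*
  (x , x≉0) ⁻¹ with x⁻¹ , xx⁻¹≈1 ← invertible x x≉0 =
    x⁻¹ , λ x⁻¹≈0 → 1≉0 (≈-trans (≈-sym xx⁻¹≈1) (≈-trans (*-congˡ x⁻¹≈0) (zeroʳ x)))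

  infixl 7 _·_
  _·_ : F* → F* → F*
  (x , x≉0) · (y , y≉0) = x *ᶠ y , *-nonzero x≉0 y≉0

  infixr 7 _⊙_
  _⊙_ : F* → Carrier → Carrier
  u ⊙ x = proj₁ u *ᶠ x

  solve-⊙ : ∀ u {x y} → x ≈ u ⊙ y → y ≈ u ⁻¹ ⊙ x
  solve-⊙ (u , u≉0) {x} {y} x≈uy with u⁻¹ , uu⁻¹≈1 ← invertible u u≉0 = begin
    y                 ≈⟨ *ᶠ-identityˡ y ⟨
    1# *ᶠ y           ≈⟨ *-congʳ (≈-trans (*ᶠ-comm _ _) uu⁻¹≈1) ⟨
    (u⁻¹ *ᶠ u) *ᶠ y   ≈⟨ *ᶠ-assoc _ _ _ ⟩
    u⁻¹ *ᶠ (u *ᶠ y)   ≈⟨ *-congˡ x≈uy ⟨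
    u⁻¹ *ᶠ x          ∎

  chain-⊙ : ∀ u w {x y z} → x ≈ u ⊙ y → y ≈ w ⊙ z → x ≈ (u · w) ⊙ z
  chain-⊙ u w x≈uy y≈wz = ≈-trans x≈uy (≈-trans (*-congˡ y≈wz) (≈-sym (*ᶠ-assoc _ _ _)))

  unit : ∀ {k} → Fin k → Word k
  unit zero    zero    = 1#
  unit zero    (suc i) = 0#
  unit (suc r) zero    = 0#
  unit (suc r) (suc i) = unit r i

  combination-unit : ∀ {k n} (G : Matrix k n) r j → combination (unit r) G j ≈ G r j
  combination-unit {suc k} G zero j = begin
    1# *ᶠ G zero j +ᶠ sum (λ i → 0# *ᶠ G (suc i) j)
      ≈⟨ +-cong (*ᶠ-identityˡ _) (≈-trans (sum-cong-≋ (λ i → zeroˡ (G (suc i) j))) (sum-replicate-zero k)) ⟩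
    G zero j +ᶠ 0#  ≈⟨ +ᶠ-identityʳ _ ⟩
    G zero j        ∎
  combination-unit G (suc r) j = begin
    0# *ᶠ G zero j +ᶠ combination (unit r) (G ∘ suc) j ≈⟨ +-cong (zeroˡ _) (combination-unit (G ∘ suc) r j) ⟩
    0# +ᶠ G (suc r) j  ≈⟨ +ᶠ-identityˡ _ ⟩
    G (suc r) j        ∎

  -- Quantified over coefficient words instead of rows, so that it composes directly with `Aligned`;
  -- `proportional?` passes to rows through unit words. As the factor is nonzero, the zero columns
  -- form a class of their own.
  Proportional : ∀ {k n} → Matrix k n → Fin n → Fin n → Set
  Proportional G i j = Σ[ u ∈ F* ] ∀ a → combination a G i ≈ u ⊙ combination a G j

  proportional? : ∀ {k n} (G : Matrix k n) i j → Dec (Proportional G i j)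
  proportional? G i j = map′ fromRows toRows
    (Fin.any? λ e → ¬? (element e ≟ 0#) ×-dec Fin.all? λ r → G r i ≟ element e *ᶠ G r j)
    where
    element = Inverse.from enumeration

    fromRows : (∃[ e ] element e ≉ 0# × (∀ r → G r i ≈ element e *ᶠ G r j)) → Proportional G i j
    fromRows (e , e≉0 , rows) = (element e , e≉0) , λ a → begin
      sum (λ r → a r *ᶠ G r i)
        ≈⟨ sum-cong-≋ (λ r → ≈-trans (*-congˡ (rows r)) (x∙yz≈y∙xz (a r) (element e) (G r j))) ⟩
      sum (λ r → element e *ᶠ (a r *ᶠ G r j))  ≈⟨ *-distribˡ-sum (element e) (λ r → a r *ᶠ G r j) ⟨
      element e *ᶠ combination a G j           ∎

    toRows : Proportional G i j → ∃[ e ] element e ≉ 0# × (∀ r → G r i ≈ element e *ᶠ G r j)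
    toRows ((u , u≉0) , p) = Inverse.to enumeration u , (λ e≈0 → u≉0 (≈-trans (≈-sym e≈u) e≈0)) , λ r → begin
      G r i                       ≈⟨ combination-unit G r i ⟨
      combination (unit r) G i    ≈⟨ p (unit r) ⟩
      u *ᶠ combination (unit r) G j ≈⟨ *-cong (≈-sym e≈u) (combination-unit G r j) ⟩
      element _ *ᶠ G r j          ∎
      where
      e≈u : element (Inverse.to enumeration u) ≈ u
      e≈u = Inverse.strictlyInverseʳ enumeration u

  proportional-refl : ∀ {k n} (G : Matrix k n) {i} → Proportional G i i
  proportional-refl G = (1# , 1≉0) , λ a → ≈-sym (*ᶠ-identityˡ _)

  proportional-sym : ∀ {k n} (G : Matrix k n) {i j} → Proportional G i j → Proportional G j i
  proportional-sym G (u , p) = u ⁻¹ , λ a → solve-⊙ u (p a)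

  proportional-trans : ∀ {k n} (G : Matrix k n) {i j l} →
    Proportional G i j → Proportional G j l → Proportional G i l
  proportional-trans G (u , p) (w , r) = u · w , λ a → chain-⊙ u w (p a) (r a)

  columns : ∀ {k n} → Matrix k n → DecSetoid 0ℓ 0ℓ
  columns {n = n} G = record
    { Carrier = Fin n
    ; _≈_     = Proportional G
    ; isDecEquivalence = record
      { isEquivalence = record
        { refl  = proportional-refl G
        ; sym   = proportional-sym G
        ; trans = proportional-trans G }
      ; _≟_ = proportional? G } }

  -- A coupling pairs the coefficient words of codewords that an isometry
  -- identifies; it survives the repetition of columns unchanged.
  record Coupling (k : ℕ) : Set₁ where
    field
      Pairs  : Word k → Word k → Set
      totalˡ : ∀ a → ∃[ c ] Pairs a c
      totalʳ : ∀ c → ∃[ a ] Pairs a c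

  open Coupling

  Aligned : ∀ {k n} → Coupling k → (G H : Matrix k n) → Fin n → Fin n → Set
  Aligned K G H i j = Σ[ u ∈ F* ] ∀ a c → Pairs K a c → combination c H j ≈ u ⊙ combination a G i

  module _ {k n} (K : Coupling k) (G H : Matrix k n) where

    aligned-respʳ : ∀ {i j j′} → Aligned K G H i j → Proportional H j j′ → Aligned K G H i j′
    aligned-respʳ (u , p) (w , r) = w ⁻¹ · u , λ a c ac → chain-⊙ (w ⁻¹) u (solve-⊙ w (r c)) (p a c ac)

    aligned-respˡ : ∀ {i i′ j} → Aligned K G H i j → Proportional G i i′ → Aligned K G H i′ j
    aligned-respˡ (u , p) (w , r) = u · w , λ a c ac → chain-⊙ u w (p a c ac) (r a)

    -- Totality of the coupling: any partner `a` of `c` expresses both columns of `H` through the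
    -- same value `combination a G i`.
    aligned-functional : ∀ {i j j′} → Aligned K G H i j → Aligned K G H i j′ → Proportional H j j′
    aligned-functional (u , p) (w , r) = u · w ⁻¹ , λ c → let a , ac = totalʳ K c in
      chain-⊙ u (w ⁻¹) (p a c ac) (solve-⊙ w (r a c ac))

    aligned-injective : ∀ {i i′ j} → Aligned K G H i j → Aligned K G H i′ j → Proportional G i i′
    aligned-injective (u , p) (w , r) = u ⁻¹ · w , λ a → let c , ac = totalˡ K a in
      chain-⊙ (u ⁻¹) w (solve-⊙ u (p a c ac)) (r a c ac)

    -- The scalars are read off the alignment. The search therefore looks for the permutation alone,
    -- and each image matters only up to proportionality.
    aligned⇒isometry : (σ : Permutation′ n) → (∀ i → Aligned K G H i (σ ⟨$⟩ʳ i)) →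
                       Σ[ v ∈ Vector F* n ] image (σ , v) ⟨ G ⟩ ≐ ⟨ H ⟩
    aligned⇒isometry σ aligned = v , image⊆ , ⊆image
      where
      v : Vector F* n
      v j = proj₁ (aligned (σ ⟨$⟩ˡ j))

      scaled : ∀ {a c} → Pairs K a c → ∀ i →
               combination c H (σ ⟨$⟩ʳ i) ≈ v (σ ⟨$⟩ʳ i) ⊙ combination a G i
      scaled {a} {c} ac i = subst (λ i′ → combination c H (σ ⟨$⟩ʳ i) ≈ proj₁ (aligned i′) ⊙ combination a G i)
        (sym (inverseˡ σ)) (proj₂ (aligned i) a c ac)

      image⊆ : ∀ {y} → image (σ , v) ⟨ G ⟩ y → ⟨ H ⟩ y
      image⊆ {y} (x , (a , x≈aG) , x↦y) with c , ac ← totalˡ K a = c , λ j →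
        subst (λ j′ → y j′ ≈ combination c H j′) (inverseʳ σ)
          (≈-trans (x↦y _) (≈-trans (*-congˡ (x≈aG _)) (≈-sym (scaled ac _))))

      ⊆image : ∀ {y} → ⟨ H ⟩ y → image (σ , v) ⟨ G ⟩ y
      ⊆image (c , y≈cH) with a , ac ← totalʳ K c =
        combination a G , (a , λ _ → ≈-refl) , λ i → ≈-trans (y≈cH _) (scaled ac i)

  record Equivalence {k n} (G H : Matrix k n) : Set₁ where
    field
      coupling    : Coupling k
      permutation : Permutation′ n
      aligned     : ∀ i → Aligned coupling G H i (permutation ⟨$⟩ʳ i)

  open Equivalence public

  -- The coupling is the very relation that makes all columns aligned; its totality on either side
  -- comes from one of the two inclusions. A relation spares the construction of an invertible
  -- change of basis.
  fromLinearlyEquivalent : ∀ {k n} (G H : Matrix k n) → LinearlyEquivalent ⟨ G ⟩ ⟨ H ⟩ → Equivalence G H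
  fromLinearlyEquivalent {k} G H ((σ , v) , image⊆ , ⊆image) = record
    { coupling    = record { Pairs = paired ; totalˡ = totalˡ′ ; totalʳ = totalʳ′ }
    ; permutation = σ
    ; aligned     = λ i → v (σ ⟨$⟩ʳ i) , λ a c ac → ac i }
    where
    paired : Word k → Word k → Set
    paired a c = ∀ i → combination c H (σ ⟨$⟩ʳ i) ≈ v (σ ⟨$⟩ʳ i) ⊙ combination a G i

    totalˡ′ : ∀ a → ∃[ c ] paired a c
    totalˡ′ a with c , y≈cH ← image⊆ {λ j → v j ⊙ combination a G (σ ⟨$⟩ˡ j)}
                     (combination a G , (a , λ _ → ≈-refl) ,
                      λ i → *-congˡ (≈-reflexive (cong (combination a G) (inverseˡ σ))))
      = c , λ i → ≈-trans (≈-sym (y≈cH _)) (*-congˡ (≈-reflexive (cong (combination a G) (inverseˡ σ))))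

    totalʳ′ : ∀ c → ∃[ a ] paired a c
    totalʳ′ c with x , (a , x≈aG) , x↦y ← ⊆image {combination c H} (c , λ _ → ≈-refl) =
      a , λ i → ≈-trans (x↦y i) (*-congˡ (x≈aG i))

  toLinearlyEquivalent : ∀ {k n} {G H : Matrix k n} → Equivalence G H → LinearlyEquivalent ⟨ G ⟩ ⟨ H ⟩
  toLinearlyEquivalent {G = G} {H} E
    with v , eq ← aligned⇒isometry (coupling E) G H (permutation E) (aligned E) = (permutation E , v) , eq

  identity : ∀ {k n} (G : Matrix k n) → Equivalence G G
  identity G = record
    { coupling    = record { Pairs = λ a c → ∀ i → combination c G i ≈ combination a G i
                           ; totalˡ = λ a → a , λ _ → ≈-refl ; totalʳ = λ c → c , λ _ → ≈-refl }
    ; permutation = Permutation.id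
    ; aligned     = λ i → (1# , 1≉0) , λ a c ac → ≈-trans (ac i) (≈-sym (*ᶠ-identityˡ _)) }

  module _ {k n} {G H : Matrix k n} (E : Equivalence G H) where

    permutation-cong : ∀ {i j} → Proportional G i j →
      Proportional H (permutation E ⟨$⟩ʳ i) (permutation E ⟨$⟩ʳ j)
    permutation-cong i~j = aligned-functional (coupling E) G H
      (aligned-respˡ (coupling E) G H (aligned E _) i~j) (aligned E _)

    permutation-injective : ∀ {i j} →
      Proportional H (permutation E ⟨$⟩ʳ i) (permutation E ⟨$⟩ʳ j) → Proportional G i j
    permutation-injective σi~σj = aligned-injective (coupling E) G H
      (aligned-respʳ (coupling E) G H (aligned E _) σi~σj) (aligned E _)

-- Queries

-- A class of proportional columns has at most n columns of its own, so its
-- copies, which come in multiples of n, can be told apart from them.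
blocks : ∀ {A : Set} → ℕ → List A → List A
blocks n []       = []
blocks n (x ∷ xs) = replicate (n * suc (length xs)) x ++ blocks n xs

-- The label of an entry is its position counted from the end, so that prepending an entry leaves
-- the earlier labels unchanged.
weightedCount : ∀ {A : Set} → (A → Bool) → List A → ℕ
weightedCount p []       = 0
weightedCount p (x ∷ xs) = indicator (p x) * suc (length xs) + weightedCount p xs

map-blocks : ∀ {A B : Set} (f : A → B) n xs → map f (blocks n xs) ≡ blocks n (map f xs)
map-blocks f n []       = refl
map-blocks f n (x ∷ xs) = begin
  map f (replicate (n * suc (length xs)) x ++ blocks n xs)
    ≡⟨ map-++ f (replicate (n * suc (length xs)) x) (blocks n xs) ⟩
  map f (replicate (n * suc (length xs)) x) ++ map f (blocks n xs)
    ≡⟨ cong₂ _++_ (map-replicate f (n * suc (length xs)) x) (map-blocks f n xs) ⟩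
  replicate (n * suc (length xs)) (f x) ++ blocks n (map f xs)
    ≡⟨ cong (λ l → replicate (n * suc l) (f x) ++ blocks n (map f xs)) (length-map f xs) ⟨
  replicate (n * suc (length (map f xs))) (f x) ++ blocks n (map f xs) ∎
  where open ≡-Reasoning

count-blocks : ∀ {A : Set} (p : A → Bool) n xs → count p (blocks n xs) ≡ n * weightedCount p xs
count-blocks p n []       = sym (*-zeroʳ n)
count-blocks p n (x ∷ xs) = begin
  count p (replicate (n * suc (length xs)) x ++ blocks n xs)
    ≡⟨ count-++ p (replicate (n * suc (length xs)) x) (blocks n xs) ⟩
  count p (replicate (n * suc (length xs)) x) + count p (blocks n xs)
    ≡⟨ cong₂ _+_ (count-replicate p (n * suc (length xs)) x) (count-blocks p n xs) ⟩
  n * suc (length xs) * indicator (p x) + n * weightedCount p xs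
    ≡⟨ cong (_+ n * weightedCount p xs)
         (trans (*-assoc n _ _) (cong (n *_) (*-comm (suc (length xs)) _))) ⟩
  n * (indicator (p x) * suc (length xs)) + n * weightedCount p xs
    ≡⟨ *-distribˡ-+ n _ _ ⟨
  n * (indicator (p x) * suc (length xs) + weightedCount p xs) ∎
  where open ≡-Reasoning

-- The blocks add up to n times a triangular number, doubled here to avoid division.
length-blocks : ∀ {A : Set} n (xs : List A) → length (blocks n xs) * 2 ≡ n * (length xs * suc (length xs))
length-blocks n []       = sym (*-zeroʳ n)
length-blocks n (x ∷ xs) = begin
  length (replicate (n * suc l) x ++ blocks n xs) * 2
    ≡⟨ cong (_* 2) (trans (length-++ (replicate (n * suc l) x)) (cong (_+ length (blocks n xs)) (length-replicate (n * suc l)))) ⟩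
  (n * suc l + length (blocks n xs)) * 2      ≡⟨ *-distribʳ-+ 2 (n * suc l) _ ⟩
  n * suc l * 2 + length (blocks n xs) * 2    ≡⟨ cong (n * suc l * 2 +_) (length-blocks n xs) ⟩
  n * suc l * 2 + n * (l * suc l)             ≡⟨ cong (_+ n * (l * suc l)) (*-assoc n (suc l) 2) ⟩
  n * (suc l * 2) + n * (l * suc l)           ≡⟨ *-distribˡ-+ n (suc l * 2) _ ⟨
  n * (suc l * 2 + l * suc l)                 ≡⟨ cong (n *_) (cong₂ _+_ (*-comm (suc l) 2) refl) ⟩
  n * (2 * suc l + l * suc l)                 ≡⟨ cong (n *_) (*-distribʳ-+ (suc l) 2 l) ⟨
  n * (suc (suc l) * suc l)                   ≡⟨ cong (n *_) (*-comm (suc (suc l)) (suc l)) ⟩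
  n * (suc l * suc (suc l))                   ∎
  where open ≡-Reasoning
        l = length xs

all-replicate : ∀ {A : Set} {P : A → Set} n {x} → P x → All P (replicate n x)
all-replicate zero    px = []
all-replicate (suc n) px = px ∷ all-replicate n px

all-blocks : ∀ {A : Set} {P : A → Set} n {xs} → All P xs → All P (blocks n xs)
all-blocks n []         = []
all-blocks n {x ∷ xs} (px ∷ ps) = All.++⁺ (all-replicate (n * suc (length xs)) px) (all-blocks n ps)

divMod-unique : ∀ {d} w w′ {r r′} → r < d → r′ < d → w * d + r ≡ w′ * d + r′ → w ≡ w′ × r ≡ r′
divMod-unique {d} w w′ {r} {r′} r<d r′<d eq = w≡w′ , r≡r′
  where
  instance d≢0 = >-nonZero (≤-<-trans z≤n r<d)

  remainder : ∀ w {r} → r < d → (w * d + r) % d ≡ r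
  remainder w {r} r<d = begin
    (w * d + r) % d ≡⟨ cong (_% d) (+-comm (w * d) r) ⟩
    (r + w * d) % d ≡⟨ [m+kn]%n≡m%n r w d ⟩
    r % d           ≡⟨ m<n⇒m%n≡m r<d ⟩
    r               ∎
    where open ≡-Reasoning

  r≡r′ : r ≡ r′
  r≡r′ = trans (sym (remainder w r<d)) (trans (cong (_% d) eq) (remainder w′ r′<d))

  w≡w′ : w ≡ w′
  w≡w′ = *-cancelʳ-≡ w w′ d (+-cancelʳ-≡ r _ _ (trans eq (cong (w′ * d +_) (sym r≡r′))))

indicator-injective : ∀ {b c} → indicator b ≡ indicator c → b ≡ c
indicator-injective {true}  {true}  _ = refl
indicator-injective {false} {false} _ = refl

-- Recovering labels from the weight of a class

module Separation (S : DecSetoid 0ℓ 0ℓ) where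
  open DecSetoid S using (_≈_; _≟_) renaming (Carrier to X; sym to ~-sym; trans to ~-trans)
  open Matching S public

  Separated : List X → Set
  Separated = AllPairs (λ x y → ¬ x ≈ y)

  weightedCount-absent : ∀ x {ys} → All (λ y → ¬ x ≈ y) ys → weightedCount (x ~ᵇ_) ys ≡ 0
  weightedCount-absent x []               = refl
  weightedCount-absent x {y ∷ ys} (x≉y ∷ x≉ys) =
    cong₂ (λ b w → indicator b * suc (length ys) + w) (dec-false (x ≟ y) x≉y) (weightedCount-absent x x≉ys)

  -- By transitivity at most one entry lies in the class of `x`, and no label exceeds the length.
  weightedCount-separated : ∀ x {ys} → Separated ys → weightedCount (x ~ᵇ_) ys ≤ length ys
  weightedCount-separated x []                       = z≤n
  weightedCount-separated x {y ∷ ys} (y≉ys ∷ sep) with x ≟ y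
  ... | no  _   = m≤n⇒m≤1+n (weightedCount-separated x sep)
  ... | yes x≈y = ≤-reflexive (trans
    (cong (1 * suc (length ys) +_) (weightedCount-absent x
      (All.map (λ y≉z x≈z → y≉z (~-trans (~-sym x≈y) x≈z)) y≉ys)))
    (trans (+-identityʳ _) (*-identityˡ _)))

module _ (S T : DecSetoid 0ℓ 0ℓ) where
  open Separation S using () renaming (Separated to Separatedˢ; _~ᵇ_ to _~ˢ_; weightedCount-separated to boundˢ)
  open Separation T using () renaming (Separated to Separatedᵗ; _~ᵇ_ to _~ᵗ_; weightedCount-separated to boundᵗ)

  -- The first label exceeds the total weight that the later ones can give to
  -- a single class, so the weight of a class determines its labels.
  weightedCount-determines : ∀ z zs →
    Separatedˢ (map proj₁ zs) → Separatedᵗ (map proj₂ zs) → ∀ x y →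
    weightedCount (x ~ˢ_) (map proj₁ (z ∷ zs)) ≡ weightedCount (y ~ᵗ_) (map proj₂ (z ∷ zs)) →
    All (λ p → (x ~ˢ proj₁ p) ≡ (y ~ᵗ proj₂ p)) (z ∷ zs)
  weightedCount-determines z zs sepˢ sepᵗ x y eq =
    indicator-injective (proj₁ split) ∷ later zs sepˢ sepᵗ (proj₂ split)
    where
    bˢ = indicator (x ~ˢ proj₁ z)
    bᵗ = indicator (y ~ᵗ proj₂ z)
    wˢ = weightedCount (x ~ˢ_) (map proj₁ zs)
    wᵗ = weightedCount (y ~ᵗ_) (map proj₂ zs)

    -- The first entry may lie in a class that already has a label, as a candidate pair does when
    -- its column repeats a class; the bound on the remainder therefore concerns the rest of the
    -- list.
    split : bˢ ≡ bᵗ × wˢ ≡ wᵗ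
    split = divMod-unique bˢ bᵗ
      (s≤s (subst (wˢ ≤_) (length-map proj₁ zs) (boundˢ x sepˢ)))
      (s≤s (subst (wᵗ ≤_) (length-map proj₂ zs) (boundᵗ y sepᵗ)))
      (begin
        bˢ * suc (length zs) + wˢ                 ≡⟨ cong (λ l → bˢ * suc l + wˢ) (length-map proj₁ zs) ⟨
        bˢ * suc (length (map proj₁ zs)) + wˢ     ≡⟨ eq ⟩
        bᵗ * suc (length (map proj₂ zs)) + wᵗ     ≡⟨ cong (λ l → bᵗ * suc l + wᵗ) (length-map proj₂ zs) ⟩
        bᵗ * suc (length zs) + wᵗ                 ∎)
      where open ≡-Reasoning

    later : ∀ zs → Separatedˢ (map proj₁ zs) → Separatedᵗ (map proj₂ zs) →
      weightedCount (x ~ˢ_) (map proj₁ zs) ≡ weightedCount (y ~ᵗ_) (map proj₂ zs) →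
      All (λ p → (x ~ˢ proj₁ p) ≡ (y ~ᵗ proj₂ p)) zs
    later []       _          _          _  = []
    later (z ∷ zs) (_ ∷ sepˢ) (_ ∷ sepᵗ) eq = weightedCount-determines z zs sepˢ sepᵗ x y eq

-- Reversed, because the program prepends the entries of `blocks` to a row one by one.
labelledCopies : ∀ {n} → List (Fin n × Fin n) → List (Fin n × Fin n)
labelledCopies {n} L = reverse (blocks n L)

position : ∀ {A : Set} {n} → (A → Fin n) → (zs : List A) → Fin (length zs + n) → Fin n
position f []       p       = p
position f (z ∷ zs) zero    = f z
position f (z ∷ zs) (suc p) = position f zs p

position-↑ʳ : ∀ {A : Set} {n} (f : A → Fin n) zs i → position f zs (length zs ↑ʳ i) ≡ i
position-↑ʳ f []       i = refl
position-↑ʳ f (z ∷ zs) i = position-↑ʳ f zs i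

tabulate-position : ∀ {A B : Set} {n} (f : A → Fin n) (h : Fin n → B) zs →
  tabulate (h ∘ position f zs) ≡ map (h ∘ f) zs ++ tabulate h
tabulate-position f h []       = refl
tabulate-position f h (z ∷ zs) = cong (h (f z) ∷_) (tabulate-position f h zs)

-- Every copy stays in place, which pairs the copies of a label in one code with those of the same
-- label in the other.
extendPermutation : ∀ {A : Set} {n} (zs : List A) → Permutation′ n → Permutation′ (length zs + n)
extendPermutation []       σ = σ
extendPermutation (z ∷ zs) σ = lift₀ (extendPermutation zs σ)

-- A class has between 1 and n columns, so its size less one is a remainder modulo n; the size
-- itself is not if all columns are proportional.
count-allFin : ∀ {n} (p : Fin n → Bool) i → p i ≡ true → ∃[ s ] count p (allFin n) ≡ suc s × s < n
count-allFin {suc n} p i pi = count p (tabulate (punchIn i)) ,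
  trans (count-tabulate-punchIn p id i)
    (cong (λ b → indicator b + count p (tabulate (punchIn i))) pi) ,
  s≤s (subst (count p (tabulate (punchIn i)) ≤_) (length-tabulate (punchIn i)) (count-≤-length p (tabulate (punchIn i))))

-- Equivalence of the extended codes

module QueryProperties (F : FiniteField) where
  open FiniteField F
  open Codes F
  open CodeProperties F
  open Coupling

  repeatColumns : ∀ {A : Set} {k n} → (A → Fin n) → (zs : List A) → Matrix k n → Matrix k (length zs + n)
  repeatColumns f zs G r p = G r (position f zs p)

  module _ {k n : ℕ} (G H : Matrix k n) where

    repeated : (zs : List (Fin n × Fin n)) (E : Equivalence G H) →
      All (λ z → Proportional H (proj₂ z) (permutation E ⟨$⟩ʳ proj₁ z)) zs →
      Equivalence (repeatColumns proj₁ zs G) (repeatColumns proj₂ zs H)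
    repeated zs E linked = record
      { coupling    = coupling E
      ; permutation = extendPermutation zs (permutation E)
      ; aligned     = aligned′ zs linked }
      where
      aligned′ : ∀ zs → All (λ z → Proportional H (proj₂ z) (permutation E ⟨$⟩ʳ proj₁ z)) zs → ∀ p →
        Aligned (coupling E) G H (position proj₁ zs p)
          (position proj₂ zs (extendPermutation zs (permutation E) ⟨$⟩ʳ p))
      aligned′ []       _        p       = aligned E p
      aligned′ (z ∷ zs) (s ∷ ss) zero    =
        aligned-respʳ (coupling E) G H (aligned E (proj₁ z)) (proportional-sym H s)
      aligned′ (z ∷ zs) (s ∷ ss) (suc p) = aligned′ zs ss p

    module _ (L : List (Fin n × Fin n)) (z : Fin n × Fin n) where

      private
        zs = labelledCopies (z ∷ L)
        module ColumnsG = Separation (columns G)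
        module ColumnsH = Separation (columns H)
        open ColumnsG using () renaming (_~ᵇ_ to _~ᴳ_)
        open ColumnsH using () renaming (_~ᵇ_ to _~ᴴ_)

      complete : (E : Equivalence G H) →
        All (λ z → Proportional H (proj₂ z) (permutation E ⟨$⟩ʳ proj₁ z)) (z ∷ L) →
        Equivalence (repeatColumns proj₁ zs G) (repeatColumns proj₂ zs H)
      complete E linked = repeated zs E (All-resp-↭ (↭-sym (↭-reverse (blocks n (z ∷ L)))) (all-blocks n linked))

      count-positions : (f : Fin n × Fin n → Fin n) (p : Fin n → Bool) →
        count p (tabulate (position f zs)) ≡ weightedCount p (map f (z ∷ L)) * n + count p (allFin n)
      count-positions f p = begin
        count p (tabulate (position f zs))
          ≡⟨ cong (count p) (tabulate-position f id zs) ⟩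
        count p (map f zs ++ allFin n)                   ≡⟨ count-++ p (map f zs) (allFin n) ⟩
        count p (map f zs) + count p (allFin n)          ≡⟨ cong (_+ count p (allFin n)) (begin
          count p (map f zs)                             ≡⟨ count-↭ p (↭-map⁺ f (↭-reverse (blocks n (z ∷ L)))) ⟩
          count p (map f (blocks n (z ∷ L)))             ≡⟨ cong (count p) (map-blocks f n (z ∷ L)) ⟩
          count p (blocks n (map f (z ∷ L)))             ≡⟨ count-blocks p n (map f (z ∷ L)) ⟩
          n * weightedCount p (map f (z ∷ L))            ≡⟨ *-comm n _ ⟩
          weightedCount p (map f (z ∷ L)) * n            ∎) ⟩
        weightedCount p (map f (z ∷ L)) * n + count p (allFin n) ∎
        where open ≡-Reasoning

      -- The given permutation sends the original position of `i` to an original or a copy of some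
      -- column `b i`. The function `b` need not be injective, but it hits each class as often as
      -- the class has columns, and `matching` turns it into a permutation that agrees with it up to
      -- proportionality.
      sound : ColumnsG.Separated (map proj₁ L) → ColumnsH.Separated (map proj₂ L) →
        Equivalence (repeatColumns proj₁ zs G) (repeatColumns proj₂ zs H) →
        Σ[ E ∈ Equivalence G H ]
          All (λ z → Proportional H (proj₂ z) (permutation E ⟨$⟩ʳ proj₁ z)) (z ∷ L)
      sound sepᴳ sepᴴ E′ = E , All.tabulate link
        where
        K  = coupling E′
        σ′ = permutation E′

        b : Fin n → Fin n
        b i = position proj₂ zs (σ′ ⟨$⟩ʳ (length zs ↑ʳ i))

        aligned-b : ∀ i → Aligned K G H i (b i)
        aligned-b i = subst (λ i′ → Aligned K G H i′ (b i)) (position-↑ʳ proj₁ zs i) (aligned E′ (length zs ↑ʳ i))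

        same-class : ∀ {i j i′ j′} → Aligned K G H i j → Aligned K G H i′ j′ → (i ~ᴳ i′) ≡ (j ~ᴴ j′)
        same-class ij i′j′ = does-⇔ (mk⇔
          (λ i~i′ → aligned-functional K G H (aligned-respˡ K G H ij i~i′) i′j′)
          (λ j~j′ → aligned-injective K G H (aligned-respʳ K G H ij j~j′) i′j′))
          (proportional? G _ _) (proportional? H _ _)

        same-count : ∀ {i j} → Aligned K G H i j →
          count (i ~ᴳ_) (tabulate (position proj₁ zs)) ≡ count (j ~ᴴ_) (tabulate (position proj₂ zs))
        same-count {i} {j} ij = trans
          (count-tabulate-cong (i ~ᴳ_) (j ~ᴴ_) (position proj₁ zs) (position proj₂ zs ∘ (σ′ ⟨$⟩ʳ_))
            (λ p → same-class ij (aligned E′ p)))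
          (count-tabulate-permute (j ~ᴴ_) (position proj₂ zs) σ′)

        same-weight-size : ∀ {i j} → Aligned K G H i j →
          weightedCount (i ~ᴳ_) (map proj₁ (z ∷ L)) ≡ weightedCount (j ~ᴴ_) (map proj₂ (z ∷ L)) ×
          count (i ~ᴳ_) (allFin n) ≡ count (j ~ᴴ_) (allFin n)
        same-weight-size {i} {j} ij = proj₁ both , trans sᴳ≡ (trans (cong suc (proj₂ both)) (sym sᴴ≡))
          where
          open ≡-Reasoning
          wᴳ = weightedCount (i ~ᴳ_) (map proj₁ (z ∷ L))
          wᴴ = weightedCount (j ~ᴴ_) (map proj₂ (z ∷ L))
          sizeᴳ = count-allFin (i ~ᴳ_) i (ColumnsG.~ᵇ-refl i)
          sizeᴴ = count-allFin (j ~ᴴ_) j (ColumnsH.~ᵇ-refl j)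
          sᴳ = proj₁ sizeᴳ
          sᴴ = proj₁ sizeᴴ
          sᴳ≡ = proj₁ (proj₂ sizeᴳ)
          sᴴ≡ = proj₁ (proj₂ sizeᴴ)

          both : wᴳ ≡ wᴴ × sᴳ ≡ sᴴ
          both = divMod-unique wᴳ wᴴ (proj₂ (proj₂ sizeᴳ)) (proj₂ (proj₂ sizeᴴ)) (suc-injective (begin
            suc (wᴳ * n + sᴳ)                   ≡⟨ +-suc (wᴳ * n) sᴳ ⟨
            wᴳ * n + suc sᴳ                     ≡⟨ cong (wᴳ * n +_) sᴳ≡ ⟨
            wᴳ * n + count (i ~ᴳ_) (allFin n)   ≡⟨ count-positions proj₁ (i ~ᴳ_) ⟨
            count (i ~ᴳ_) (tabulate (position proj₁ zs)) ≡⟨ same-count ij ⟩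
            count (j ~ᴴ_) (tabulate (position proj₂ zs)) ≡⟨ count-positions proj₂ (j ~ᴴ_) ⟩
            wᴴ * n + count (j ~ᴴ_) (allFin n)   ≡⟨ cong (wᴴ * n +_) sᴴ≡ ⟩
            wᴴ * n + suc sᴴ                     ≡⟨ +-suc (wᴴ * n) sᴴ ⟩
            suc (wᴴ * n + sᴴ)                   ∎))

        determined : ∀ i → All (λ z → (i ~ᴳ proj₁ z) ≡ (b i ~ᴴ proj₂ z)) (z ∷ L)
        determined i = weightedCount-determines (columns G) (columns H) z L sepᴳ sepᴴ i (b i)
          (proj₁ (same-weight-size (aligned-b i)))

        matched : Σ[ σ ∈ Permutation′ n ] (∀ i → Proportional H (b i) (σ ⟨$⟩ʳ i))
        matched = ColumnsH.matching b id counts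
          where
          counts : ∀ x → count (x ~ᴴ_) (tabulate b) ≡ count (x ~ᴴ_) (allFin n)
          counts x = begin
            count (x ~ᴴ_) (tabulate b)   ≡⟨ count-tabulate-cong (i ~ᴳ_) (x ~ᴴ_) id b (λ i′ → same-class ix (aligned-b i′)) ⟨
            count (i ~ᴳ_) (allFin n)     ≡⟨ proj₂ (same-weight-size ix) ⟩
            count (x ~ᴴ_) (allFin n)     ∎
            where
            open ≡-Reasoning
            -- The position that is sent to the original position of `x` shows a column `i` aligned
            -- with `x`; through it the class of `x` is compared with a class of `G`.
            p = σ′ ⟨$⟩ˡ (length zs ↑ʳ x)
            i = position proj₁ zs p

            ix : Aligned K G H i x
            ix = subst (Aligned K G H i)
              (trans (cong (position proj₂ zs) (inverseʳ σ′)) (position-↑ʳ proj₂ zs x)) (aligned E′ p)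

        E : Equivalence G H
        E = record
          { coupling    = K
          ; permutation = proj₁ matched
          ; aligned     = λ i → aligned-respʳ K G H (aligned-b i) (proj₂ matched i) }

        link : ∀ {y} → y ∈ z ∷ L → Proportional H (proj₂ y) (permutation E ⟨$⟩ʳ proj₁ y)
        -- As `r` lies in its own class, equality of labels puts `s` into the class of `b r`, which
        -- contains the new image of `r`.
        link {r , s} rs∈ = proportional-trans H (proportional-sym H (ColumnsH.~ᵇ⇒~
          (trans (sym (All.lookup (determined r) rs∈)) (ColumnsG.~ᵇ-refl r)))) (proj₂ matched r)

-- Programs and their costs

infixr 5 _∙′_
_∙′_ : ∀ {m} → Term m → Term m → Term m
_∙′_ = binary cons

hd tl : ∀ {m} → Term m → Term m
hd = unary head
tl = unary tail

nil′ : ∀ {m} → Term m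
nil′ = const nil

v₀ : ∀ {m} → Term (suc m)
v₀ = var zero

-- The state pairs the remaining list with the accumulator; the free variable
-- of the last argument is that state.
fold : ∀ {m} → Term m → Term m → Term (suc m) → Term m
fold s t u = tl (from s ∙′ t while hd v₀ step (tl (hd v₀) ∙′ u))

-- An index is a unary numeral, hence a list with one entry for each cell to be dropped.
nth : ∀ {m} → Term m → Term m → Term m
nth xs i = hd (fold i xs (tl (tl v₀)))

reverseOnto : ∀ {m} → Term m → Term m → Term m
reverseOnto xs ys = fold xs ys (hd (hd v₀) ∙′ tl v₀)

-- The list `b` acts as a unary counter: one copy is made for each of its entries.
copiesOnto : ∀ {m} → Fin m → Term m → Term m → Term m
copiesOnto i b e = fold b e (var (suc i) ∙′ tl v₀)

-- The row supplies its length; the accumulator pairs the next numeral with the list of those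
-- already produced.
descendingIndices : ∀ {m} → Term m → Term m
descendingIndices row = tl (fold row (nil′ ∙′ nil′)
  ((nil′ ∙′ hd (tl v₀)) ∙′ hd (tl v₀) ∙′ tl (tl v₀)))

extendRow : ∀ {m} → Fin m → Term m → Term m
extendRow r e = fold e (var r) (nth (var (suc r)) (hd (hd v₀)) ∙′ tl v₀)

extendRows : ∀ {m} → Term m → Fin m → Term m
extendRows g e = fold g nil′
  (let′ (hd (hd v₀)) (extendRow zero (var (suc (suc e))) ∙′ tl (var (suc zero))))

extended : ∀ {m} → Fin m → Fin m → Term m → Term m → Term m
extended g i b e = let′ (copiesOnto i b e) (extendRows (var (suc g)) zero)

-- Such terms evaluate without branching or queries, so `value` and `depth` compute their result and
-- the exponent of their cost, and `straight` settles all these evaluations at once.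
Straight : ∀ {m} → Term m → Set
Straight (var i)           = ⊤
Straight (const nil)       = ⊤
Straight (unary head s)    = Straight s
Straight (unary tail s)    = Straight s
Straight (binary cons s t) = Straight s × Straight t
Straight _                 = ⊥

depth : ∀ {m} → Term m → ℕ
depth (unary _ s)    = suc (depth s)
depth (binary _ s t) = suc (depth s ⊔ depth t)
depth _              = 0

-- Evaluations with bounds on cost and queries

module CostedSemantics
  (F : FiniteField) (O : Semantics.Oracle F) (Instance : Semantics.Tree F → Set)
  (N : ℕ) (3≤N : 3 ≤ N) where

  open FiniteField F
  open Semantics F
  open Evaluation O

  instance N≢0 = >-nonZero (≤-trans (s≤s z≤n) 3≤N)

  -- e bounds the logarithm of the cost to base N, and q the number of queries.
  record Evaluates {m} (ρ : Environment m) (s : Term m) (t : Tree) (e q : ℕ) : Set where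
    constructor evaluation
    field
      cost      : ℕ
      queries   : List Tree
      run       : ρ ⊢ s ⇓ t ∣ cost , queries
      cost≤     : cost ≤ N ^ e
      length≤   : length queries ≤ q
      instances : All Instance queries

  record Loops {m} (ρ : Environment m) (s₁ s₂ : Term (suc m)) (t u : Tree) (I e q : ℕ) : Set where
    constructor looping
    field
      cost      : ℕ
      queries   : List Tree
      run       : ρ ⊢while s₁ step s₂ from t ⇓ u ∣ cost , queries
      cost≤     : cost ≤ I * N ^ e
      length≤   : length queries ≤ q
      instances : All Instance queries

  weaken : ∀ {m} {ρ : Environment m} {s t e e′ q} → e ≤ e′ → Evaluates ρ s t e q → Evaluates ρ s t e′ q
  weaken e≤e′ (evaluation c Q r c≤ l i) = evaluation c Q r (≤-trans c≤ (^-monoʳ-≤ N e≤e′)) l i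

  weaken-queries : ∀ {m} {ρ : Environment m} {s t e q q′} → q ≤ q′ → Evaluates ρ s t e q → Evaluates ρ s t e q′
  weaken-queries q≤ (evaluation c Q r c≤ l i) = evaluation c Q r c≤ (≤-trans l q≤) i

  weaken-loops : ∀ {m} {ρ : Environment m} {s₁ s₂ t u I I′ e q q′} → I ≤ I′ → q ≤ q′ →
    Loops ρ s₁ s₂ t u I e q → Loops ρ s₁ s₂ t u I′ e q′
  weaken-loops {e = e} I≤ q≤ (looping c Q r c≤ l i) =
    looping c Q r (≤-trans c≤ (*-monoˡ-≤ (N ^ e) I≤)) (≤-trans l q≤) i

  1≤N^ : ∀ e → 1 ≤ N ^ e
  1≤N^ e = m^n>0 N e

  -- Three summands of at most N^e fit into N^(e+1) because 3 ≤ N. Exponents thus follow the nesting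
  -- of the program: each construct adds one, and a loop adds in addition the exponent that bounds
  -- its number of rounds.
  step-cost : ∀ e {c₁ c₂} → c₁ ≤ N ^ e → c₂ ≤ N ^ e → 1 + c₁ + c₂ ≤ N ^ suc e
  step-cost e {c₁} {c₂} c₁≤ c₂≤ = begin
    1 + c₁ + c₂                ≤⟨ +-mono-≤ (+-mono-≤ (1≤N^ e) c₁≤) c₂≤ ⟩
    N ^ e + N ^ e + N ^ e      ≡⟨ +-assoc (N ^ e) _ _ ⟩
    N ^ e + (N ^ e + N ^ e)    ≡⟨ cong (λ x → N ^ e + (N ^ e + x)) (+-identityʳ (N ^ e)) ⟨
    3 * N ^ e                  ≤⟨ *-monoˡ-≤ (N ^ e) 3≤N ⟩
    N ^ suc e                  ∎
    where open ≤-Reasoning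

  suc-cost : ∀ e {c} → c ≤ N ^ e → 1 + c ≤ N ^ suc e
  suc-cost e c≤ = ≤-trans (≤-reflexive (sym (+-identityʳ _))) (step-cost e c≤ (z≤n {N ^ e}))

  raiseˡ : ∀ {c} e₁ e₂ → c ≤ N ^ e₁ → c ≤ N ^ (e₁ ⊔ e₂)
  raiseˡ e₁ e₂ c≤ = ≤-trans c≤ (^-monoʳ-≤ N (m≤m⊔n e₁ e₂))

  raiseʳ : ∀ {c} e₁ e₂ → c ≤ N ^ e₂ → c ≤ N ^ (e₁ ⊔ e₂)
  raiseʳ e₁ e₂ c≤ = ≤-trans c≤ (^-monoʳ-≤ N (m≤n⊔m e₁ e₂))

  length-++-≤ : ∀ {A : Set} (xs : List A) {ys p q} → length xs ≤ p → length ys ≤ q → length (xs ++ ys) ≤ p + q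
  length-++-≤ xs p q = ≤-trans (≤-reflexive (length-++ xs)) (+-mono-≤ p q)

  module _ {m} {ρ : Environment m} where

    variable′ : ∀ i → Evaluates ρ (var i) (lookup ρ i) 0 0
    variable′ i = evaluation 1 [] (var i) ≤-refl z≤n []

    nil-ev : Evaluates ρ nil′ nil 0 0
    nil-ev = evaluation 1 [] (const nil) ≤-refl z≤n []

    head-ev : ∀ {s t e q} → Evaluates ρ s t e q → Evaluates ρ (hd s) (⟦ head ⟧₁ t) (suc e) q
    head-ev {e = e} (evaluation c Q r c≤ l i) = evaluation (1 + c) Q (unary head r) (suc-cost e c≤) l i

    tail-ev : ∀ {s t e q} → Evaluates ρ s t e q → Evaluates ρ (tl s) (⟦ tail ⟧₁ t) (suc e) q
    tail-ev {e = e} (evaluation c Q r c≤ l i) = evaluation (1 + c) Q (unary tail r) (suc-cost e c≤) l i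

    cons-ev : ∀ {s₁ s₂ t₁ t₂ e₁ e₂ q₁ q₂} → Evaluates ρ s₁ t₁ e₁ q₁ → Evaluates ρ s₂ t₂ e₂ q₂ →
      Evaluates ρ (s₁ ∙′ s₂) (t₁ ∙ t₂) (suc (e₁ ⊔ e₂)) (q₁ + q₂)
    cons-ev {e₁ = e₁} {e₂} (evaluation c₁ Q₁ r₁ c₁≤ l₁ i₁) (evaluation c₂ Q₂ r₂ c₂≤ l₂ i₂) =
      evaluation (1 + c₁ + c₂) (Q₁ ++ Q₂) (binary cons r₁ r₂)
        (step-cost (e₁ ⊔ e₂) (raiseˡ e₁ e₂ c₁≤) (raiseʳ e₁ e₂ c₂≤)) (length-++-≤ Q₁ l₁ l₂) (All.++⁺ i₁ i₂)

    let-ev : ∀ {s₁ s₂ t₁ t₂ e₁ e₂ q₁ q₂} → Evaluates ρ s₁ t₁ e₁ q₁ → Evaluates (t₁ ∷ᵛ ρ) s₂ t₂ e₂ q₂ →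
      Evaluates ρ (let′ s₁ s₂) t₂ (suc (e₁ ⊔ e₂)) (q₁ + q₂)
    let-ev {e₁ = e₁} {e₂} (evaluation c₁ Q₁ r₁ c₁≤ l₁ i₁) (evaluation c₂ Q₂ r₂ c₂≤ l₂ i₂) =
      evaluation (1 + c₁ + c₂) (Q₁ ++ Q₂) (let′ r₁ r₂)
        (step-cost (e₁ ⊔ e₂) (raiseˡ e₁ e₂ c₁≤) (raiseʳ e₁ e₂ c₂≤)) (length-++-≤ Q₁ l₁ l₂) (All.++⁺ i₁ i₂)

    true-ev : ∀ {s s₁ s₂ t t₁ e e₁ q q₁} → Evaluates ρ s t e q → t ≢ nil → Evaluates ρ s₁ t₁ e₁ q₁ →
      Evaluates ρ (if s then s₁ else s₂) t₁ (suc (e ⊔ e₁)) (q + q₁)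
    true-ev {e = e} {e₁} (evaluation c Q r c≤ l i) t≢nil (evaluation c₁ Q₁ r₁ c₁≤ l₁ i₁) =
      evaluation (1 + c + c₁) (Q ++ Q₁) (if-true r t≢nil r₁)
        (step-cost (e ⊔ e₁) (raiseˡ e e₁ c≤) (raiseʳ e e₁ c₁≤)) (length-++-≤ Q l l₁) (All.++⁺ i i₁)

    false-ev : ∀ {s s₁ s₂ t₂ e e₂ q q₂} → Evaluates ρ s nil e q → Evaluates ρ s₂ t₂ e₂ q₂ →
      Evaluates ρ (if s then s₁ else s₂) t₂ (suc (e ⊔ e₂)) (q + q₂)
    false-ev {e = e} {e₂} (evaluation c Q r c≤ l i) (evaluation c₂ Q₂ r₂ c₂≤ l₂ i₂) =
      evaluation (1 + c + c₂) (Q ++ Q₂) (if-false r r₂)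
        (step-cost (e ⊔ e₂) (raiseˡ e e₂ c≤) (raiseʳ e e₂ c₂≤)) (length-++-≤ Q l l₂) (All.++⁺ i i₂)

    ask-ev : ∀ {s t e q} → Evaluates ρ s t e q → Instance t → Evaluates ρ (ask s) (bool (O t)) (suc e) (q + 1)
    ask-ev {e = e} (evaluation c Q r c≤ l i) it =
      evaluation (1 + c) (Q ++ _ ∷ []) (ask r) (suc-cost e c≤) (length-++-≤ Q l ≤-refl) (All.++⁺ i (it ∷ []))

    stop-ev : ∀ {s₁ s₂ t e q} → Evaluates (t ∷ᵛ ρ) s₁ nil e q → Loops ρ s₁ s₂ t t 1 (suc e) q
    stop-ev {e = e} (evaluation c Q r c≤ l i) =
      looping (1 + c) Q (stop r) (≤-trans (suc-cost e c≤) (≤-reflexive (sym (*-identityˡ (N ^ suc e))))) l i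

    next-ev : ∀ {s₁ s₂ t t₁ t₂ u I e q₁ q₂ q₃} → Evaluates (t ∷ᵛ ρ) s₁ t₁ e q₁ → t₁ ≢ nil →
      Evaluates (t ∷ᵛ ρ) s₂ t₂ e q₂ → Loops ρ s₁ s₂ t₂ u I (suc e) q₃ →
      Loops ρ s₁ s₂ t u (suc I) (suc e) (q₁ + (q₂ + q₃))
    next-ev {e = e} (evaluation c₁ Q₁ r₁ c₁≤ l₁ i₁) t₁≢nil (evaluation c₂ Q₂ r₂ c₂≤ l₂ i₂) (looping c₃ Q₃ r₃ c₃≤ l₃ i₃) =
      looping (1 + c₁ + c₂ + c₃) (Q₁ ++ Q₂ ++ Q₃) (next r₁ t₁≢nil r₂ r₃) (+-mono-≤ (step-cost e c₁≤ c₂≤) c₃≤)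
        (length-++-≤ Q₁ l₁ (length-++-≤ Q₂ l₂ l₃)) (All.++⁺ i₁ (All.++⁺ i₂ i₃))

    loop-ev : ∀ {s s₁ s₂ t u I e e′ q q′} l → Evaluates ρ s t e q → Loops ρ s₁ s₂ t u I e′ q′ → I ≤ N ^ l →
      Evaluates ρ (from s while s₁ step s₂) u (suc (e ⊔ (l + e′))) (q + q′)
    loop-ev {I = I} {e} {e′} l (evaluation c₁ Q₁ r₁ c₁≤ l₁ i₁) (looping c₂ Q₂ r₂ c₂≤ l₂ i₂) I≤ =
      evaluation (1 + c₁ + c₂) (Q₁ ++ Q₂) (loop r₁ r₂) (step-cost (e ⊔ (l + e′)) (raiseˡ e (l + e′) c₁≤) (raiseʳ e (l + e′) (begin
        c₂               ≤⟨ c₂≤ ⟩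
        I * N ^ e′       ≤⟨ *-monoˡ-≤ (N ^ e′) I≤ ⟩
        N ^ l * N ^ e′   ≡⟨ ^-distribˡ-+-* N l e′ ⟨
        N ^ (l + e′)     ∎)))
      (length-++-≤ Q₁ l₁ l₂) (All.++⁺ i₁ i₂)
      where open ≤-Reasoning

  value : ∀ {m} (s : Term m) → Straight s → Environment m → Tree
  value (var i)           _         ρ = lookup ρ i
  value (const nil)       _         ρ = nil
  value (unary head s)    p         ρ = ⟦ head ⟧₁ (value s p ρ)
  value (unary tail s)    p         ρ = ⟦ tail ⟧₁ (value s p ρ)
  value (binary cons s t) (p , p′)  ρ = value s p ρ ∙ value t p′ ρ

  straight : ∀ {m} (s : Term m) {p : Straight s} {ρ : Environment m} → Evaluates ρ s (value s p ρ) (depth s) 0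
  straight (var i)           = variable′ i
  straight (const nil)       = nil-ev
  straight (unary head s)    = head-ev (straight s)
  straight (unary tail s)    = tail-ev (straight s)
  straight (binary cons s t) = cons-ev (straight s) (straight t)

  toTree : List Tree → Tree
  toTree = foldr _∙_ nil

  module _ {m} {ρ : Environment m} {A : Set} (encode : A → Tree) (f : Tree → A → Tree)
           {body : Term (suc m)} {e : ℕ}
           (body-ev : ∀ x xs u → Evaluates (((encode x ∙ xs) ∙ u) ∷ᵛ ρ) body (f u x) e 0) where

    fold-loops : ∀ xs u → Loops ρ (hd v₀) (tl (hd v₀) ∙′ body)
      (toTree (map encode xs) ∙ u) (nil ∙ foldl f u xs) (suc (length xs)) (suc (suc (2 ⊔ e))) 0
    fold-loops []       u = stop-ev (weaken (s≤s z≤n) (straight (hd v₀)))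
    fold-loops (x ∷ xs) u = next-ev (weaken (s≤s z≤n) (straight (hd v₀))) (λ ())
      (cons-ev (straight (tl (hd v₀))) (body-ev x _ u)) (fold-loops xs (f u x))

    fold-ev : ∀ {s t u e₁ e₂} l xs → Evaluates ρ s (toTree (map encode xs)) e₁ 0 → Evaluates ρ t u e₂ 0 →
      length xs < N ^ l → Evaluates ρ (fold s t body) (foldl f u xs)
        (2 + (suc (e₁ ⊔ e₂) ⊔ (l + (2 + (2 ⊔ e))))) 0
    fold-ev l xs sev tev len = tail-ev (loop-ev l (cons-ev sev tev) (fold-loops xs _) len)

  resp : ∀ {m} {ρ : Environment m} {s t t′ e q} → t ≡ t′ → Evaluates ρ s t e q → Evaluates ρ s t′ e q
  resp refl r = r

  list≡toTree : ∀ {n} (v : Vector Tree n) → list v ≡ toTree (tabulate v)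
  list≡toTree {zero}  v = refl
  list≡toTree {suc n} v = cong (v zero ∙_) (list≡toTree (v ∘ suc))

  unaryNumeral≡toTree : ∀ i → unaryNumeral i ≡ toTree (map (λ _ → nil) (replicate i tt))
  unaryNumeral≡toTree zero    = refl
  unaryNumeral≡toTree (suc i) = cong (nil ∙_) (unaryNumeral≡toTree i)

  index : ∀ {n} → Fin n → Tree
  index = unaryNumeral ∘ toℕ

  indices : ∀ {n} → List (Fin n) → Tree
  indices = toTree ∘ map index

  drop-list : ∀ {n} (v : Vector Tree n) j →
    ⟦ head ⟧₁ (foldl (λ u _ → ⟦ tail ⟧₁ u) (list v) (replicate (toℕ j) tt)) ≡ v j
  drop-list {suc n} v zero    = refl
  drop-list {suc n} v (suc j) = drop-list (v ∘ suc) j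

  foldl-ʳ++ : ∀ {A : Set} (h : A → Tree) xs ys →
    foldl (λ u x → h x ∙ u) (toTree ys) xs ≡ toTree (map h xs ʳ++ ys)
  foldl-ʳ++ h []       ys = refl
  foldl-ʳ++ h (x ∷ xs) ys = foldl-ʳ++ h xs (h x ∷ ys)

  module _ {m} {ρ : Environment m} where

    nth-ev : ∀ {n s t e₁ e₂} {v : Vector Tree n} {j} → n < N →
      Evaluates ρ s (list v) e₁ 0 → Evaluates ρ t (index j) e₂ 0 →
      Evaluates ρ (nth s t) (v j) (3 + (suc (e₂ ⊔ e₁) ⊔ 5)) 0
    nth-ev {v = v} {j} n<N sev tev = resp (drop-list v j) (head-ev
      (fold-ev (λ _ → nil) (λ u _ → ⟦ tail ⟧₁ u) (λ _ _ _ → straight (tl (tl v₀))) 1 (replicate (toℕ j) tt)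
        (resp (unaryNumeral≡toTree (toℕ j)) tev) sev
        (subst (_< N ^ 1) (sym (length-replicate (toℕ j)))
          (<-trans (Fin.toℕ<n j) (≤-trans n<N (≤-reflexive (sym (^-identityʳ N))))))))

    reverseOnto-ev : ∀ {s t xs ys e₁ e₂} → length xs < N →
      Evaluates ρ s (toTree xs) e₁ 0 → Evaluates ρ t (toTree ys) e₂ 0 →
      Evaluates ρ (reverseOnto s t) (toTree (xs ʳ++ ys)) (2 + (suc (e₁ ⊔ e₂) ⊔ 6)) 0
    reverseOnto-ev {xs = xs} {ys} xs<N sev tev =
      resp (trans (foldl-ʳ++ id xs ys) (cong (λ zs → toTree (zs ʳ++ ys)) (map-id xs)))
      (fold-ev id (λ u x → x ∙ u) (λ _ _ _ → straight (hd (hd v₀) ∙′ tl v₀)) 1 xs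
        (resp (cong toTree (sym (map-id xs))) sev) tev (subst (length xs <_) (sym (^-identityʳ N)) xs<N))

    copiesOnto-ev : ∀ i {s t bs ts e₁ e₂} l → length bs < N ^ l →
      Evaluates ρ s (toTree bs) e₁ 0 → Evaluates ρ t (toTree ts) e₂ 0 →
      Evaluates ρ (copiesOnto i s t) (toTree (replicate (length bs) (lookup ρ i) ++ ts))
        (2 + (suc (e₁ ⊔ e₂) ⊔ (l + 4))) 0
    copiesOnto-ev i {bs = bs} {ts} l bs<N sev tev = resp (copies bs ts)
      (fold-ev id (λ u _ → lookup ρ i ∙ u) (λ _ _ _ → straight (var (suc i) ∙′ tl v₀)) l bs
        (resp (cong toTree (sym (map-id bs))) sev) tev bs<N)
      where
      x = lookup ρ i

      replicate-∷ : ∀ n ts → replicate n x ++ x ∷ ts ≡ x ∷ replicate n x ++ ts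
      replicate-∷ zero    ts = refl
      replicate-∷ (suc n) ts = cong (x ∷_) (replicate-∷ n ts)

      copies : ∀ (bs ts : List Tree) → foldl (λ u _ → x ∙ u) (toTree ts) bs ≡ toTree (replicate (length bs) x ++ ts)
      copies []       ts = refl
      copies (b ∷ bs) ts = trans (copies bs (x ∷ ts)) (cong toTree (replicate-∷ (length bs) ts))

    descendingIndices-ev : ∀ {n s e} {v : Vector Tree n} → n < N → Evaluates ρ s (list v) e 0 →
      Evaluates ρ (descendingIndices s) (indices (reverse (allFin n))) (3 + (suc (e ⊔ 1) ⊔ 7)) 0
    descendingIndices-ev {n} {v = v} n<N sev = resp
      (trans (countdown n id 0 [] (λ _ → refl)) (cong toTree (sym (reverse-map index (allFin n)))))
      (tail-ev (fold-ev v push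
        (λ _ _ _ → straight ((nil′ ∙′ hd (tl v₀)) ∙′ hd (tl v₀) ∙′ tl (tl v₀))) 1 (allFin n)
        (resp (trans (list≡toTree v) (cong toTree (sym (map-tabulate id v)))) sev) (straight (nil′ ∙′ nil′))
        (subst₂ _<_ (sym (length-tabulate id)) (sym (^-identityʳ N)) n<N)))
      where
      push : Tree → Fin n → Tree
      push u _ = (nil ∙ ⟦ head ⟧₁ u) ∙ ⟦ head ⟧₁ u ∙ ⟦ tail ⟧₁ u

      -- Generalised to a segment that starts at `c`, since the counter has advanced when the
      -- induction hypothesis is applied.
      countdown : ∀ j (s : Fin j → Fin n) c ys → (∀ i → toℕ (s i) ≡ c + toℕ i) →
        ⟦ tail ⟧₁ (foldl push (unaryNumeral c ∙ toTree ys) (tabulate s)) ≡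
        toTree (map index (tabulate s) ʳ++ ys)
      countdown zero    s c ys eq = refl
      countdown (suc j) s c ys eq = trans
        (countdown j (s ∘ suc) (suc c) (unaryNumeral c ∷ ys) (λ i → trans (eq (suc i)) (+-suc c (toℕ i))))
        (cong (λ m → toTree (map index (tabulate (s ∘ suc)) ʳ++ unaryNumeral m ∷ ys))
          (sym (trans (eq zero) (+-identityʳ c))))

  module _ {m} {ρ : Environment m} where

    extendRow-ev : ∀ {n} {v : Vector Tree n} {E r e} → n < N → length E < N ^ 4 →
      lookup ρ r ≡ list v → Evaluates ρ (var e) (indices E) 0 0 →
      Evaluates ρ (extendRow r (var e)) (toTree (map v E ʳ++ tabulate v)) 17 0
    extendRow-ev {v = v} {E} {r} n<N E<N r≡v eev = resp
      (trans (cong (λ t → foldl (λ u i → v i ∙ u) t E) (list≡toTree v)) (foldl-ʳ++ v E (tabulate v)))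
      (fold-ev index (λ u i → v i ∙ u)
        (λ x xs u → cons-ev (nth-ev {v = v} {x} n<N (resp r≡v (straight (var (suc r)))) (straight (hd (hd v₀)))) (straight (tl v₀)))
        4 E eev (resp r≡v (straight (var r))) E<N)

  encodeRow : ∀ {k n} → Matrix k n → Fin k → Tree
  encodeRow G r = list (λ j → atom (G r j))

  -- Reversed, because folding over the rows reverses them again.
  reversedRows : ∀ {k n} → Matrix k n → Tree
  reversedRows {k} G = toTree (map (encodeRow G) (reverse (allFin k)))

  open QueryProperties F using (repeatColumns)

  encodeRow-repeatColumns : ∀ {A : Set} {k n} (f : A → Fin n) zs (G : Matrix k n) r →
    toTree (map (λ j → atom (G r j)) (map f zs) ʳ++ tabulate (λ j → atom (G r j))) ≡
    encodeRow (repeatColumns f (reverse zs) G) r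
  encodeRow-repeatColumns f zs G r = sym (begin
    list (v ∘ position f (reverse zs))                      ≡⟨ list≡toTree (v ∘ position f (reverse zs)) ⟩
    toTree (tabulate (v ∘ position f (reverse zs)))         ≡⟨ cong toTree (tabulate-position f v (reverse zs)) ⟩
    toTree (map (v ∘ f) (reverse zs) ++ tabulate v)    ≡⟨ cong (λ ts → toTree (ts ++ tabulate v)) (reverse-map (v ∘ f) zs) ⟩
    toTree (reverse (map (v ∘ f) zs) ++ tabulate v)    ≡⟨ cong toTree (ʳ++-defn (map (v ∘ f) zs)) ⟨
    toTree (map (v ∘ f) zs ʳ++ tabulate v)             ≡⟨ cong (λ ts → toTree (ts ʳ++ tabulate v)) (map-∘ zs) ⟩
    toTree (map v (map f zs) ʳ++ tabulate v)      ∎)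
    where
    open ≡-Reasoning
    v = λ j → atom (G r j)

  module _ {m} {ρ : Environment m} where

    extendRows-ev : ∀ {A : Set} {k n} {G : Matrix k n} {f : A → Fin n} {zs g e} →
      k < N → n < N → length zs < N ^ 4 →
      Evaluates ρ (var g) (reversedRows G) 0 0 → lookup ρ e ≡ indices (map f zs) →
      Evaluates ρ (extendRows (var g) e) (encodeMatrix (repeatColumns f (reverse zs) G)) 24 0
    extendRows-ev {k = k} {n} {G} {f} {zs} {g} {e} k<N n<N zs<N gev e≡zs = resp assembled
      (fold-ev (encodeRow G) (λ u r → row r ∙ u)
        (λ r rs u → let-ev (straight (hd (hd v₀))) (cons-ev
          (resp (encodeRow-repeatColumns f zs G r)
            (extendRow-ev {v = λ j → atom (G r j)} {map f zs} n<N (subst (_< N ^ 4) (sym (length-map f zs)) zs<N) refl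
              (resp e≡zs (straight (var (suc (suc e)))))))
          (straight (tl (var (suc zero))))))
        1 (reverse (allFin k)) gev (straight nil′)
        (subst₂ _<_ (sym (trans (length-reverse (allFin k)) (length-tabulate id))) (sym (^-identityʳ N)) k<N))
      where
      row : Fin k → Tree
      row = encodeRow (repeatColumns f (reverse zs) G)

      assembled : foldl (λ u r → row r ∙ u) nil (reverse (allFin k)) ≡ list row
      assembled = begin
        foldl (λ u r → row r ∙ u) nil (reverse (allFin k))  ≡⟨ foldl-ʳ++ row (reverse (allFin k)) [] ⟩
        toTree (reverse (map row (reverse (allFin k)))) ≡⟨ cong toTree (reverse-map row (reverse (allFin k))) ⟨
        toTree (map row (reverse (reverse (allFin k)))) ≡⟨ cong (toTree ∘ map row) (reverse-involutive (allFin k)) ⟩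
        toTree (map row (allFin k))                     ≡⟨ cong toTree (map-tabulate id row) ⟩
        toTree (tabulate row)                                ≡⟨ list≡toTree row ⟨
        list row                                             ∎
        where open ≡-Reasoning

  module _ {m} {ρ : Environment m} where

    extended-ev : ∀ {A : Set} {k n} {G : Matrix k n} {f : A → Fin n} {z zs bs g i b e} →
      k < N → n < N → length bs < N ^ 3 → length (replicate (length bs) z ++ zs) < N ^ 4 →
      lookup ρ g ≡ reversedRows G → lookup ρ i ≡ index (f z) →
      Evaluates ρ b (toTree bs) 10 0 → Evaluates ρ e (indices (map f zs)) 10 0 →
      Evaluates ρ (extended g i b e)
        (encodeMatrix (repeatColumns f (reverse (replicate (length bs) z ++ zs)) G)) 25 0
    extended-ev {f = f} {z} {zs} {bs} {g} {i} k<N n<N bs<N zs<N g≡G i≡z bev eev = let-ev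
      (copiesOnto-ev i {bs = bs} {map index (map f zs)} 3 bs<N bev eev)
      (extendRows-ev {f = f} {replicate (length bs) z ++ zs} k<N n<N zs<N (resp g≡G (straight (var (suc g)))) (cong toTree (begin
        replicate (length bs) (lookup ρ i) ++ map index (map f zs)
          ≡⟨ cong (λ t → replicate (length bs) t ++ map index (map f zs)) i≡z ⟩
        replicate (length bs) (index (f z)) ++ map index (map f zs)
          ≡⟨ cong₂ _++_ (map-replicate index (length bs) (f z)) refl ⟨
        map index (replicate (length bs) (f z)) ++ map index (map f zs)
          ≡⟨ map-++ index (replicate (length bs) (f z)) (map f zs) ⟨
        map index (replicate (length bs) (f z) ++ map f zs)
          ≡⟨ cong (λ l → map index (l ++ map f zs)) (map-replicate f (length bs) z) ⟨
        map index (map f (replicate (length bs) z) ++ map f zs)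
          ≡⟨ cong (map index) (map-++ f (replicate (length bs) z) zs) ⟨
        map index (map f (replicate (length bs) z ++ zs)) ∎)))
      where open ≡-Reasoning

-- The search

-- A state is a tuple of seven lists, nested to the right. The last one, `block`, is a counter: its
-- length is n times the next label, the number of copies that the next pair receives.
todo unused images labels copies₁ copies₂ block : ∀ {m} → Term m → Term m
todo    s = hd s
unused  s = hd (tl s)
images  s = hd (tl (tl s))
labels  s = hd (tl (tl (tl s)))
copies₁ s = hd (tl (tl (tl (tl s))))
copies₂ s = hd (tl (tl (tl (tl (tl s)))))
block   s = tl (tl (tl (tl (tl (tl s)))))

-- Negated, so that it can serve as a loop condition.
rejected : ∀ {m} → (g h i j : Fin m) → (b c d : Term m) → Term m
rejected g h i j b c d =
  if ask (extended g i b c ∙′ extended h j b d) then nil′ else (nil′ ∙′ nil′)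

-- Environment: (rejected candidates ∙ other candidates), i, state, indices,
-- rows of G₂, rows of G₁, input.
imageRejected : Term 7
imageRejected = let′ (hd (tl v₀))
  (rejected 6F 5F 2F 0F (block (var 3F)) (copies₁ (var 3F)) (copies₂ (var 3F)))

findImage : Term 6
findImage = from nil′ ∙′ unused (var 1F)
  while imageRejected
  step ((hd (tl v₀) ∙′ hd v₀) ∙′ tl (tl v₀))

-- Environment: untested labels, result of findImage, i, state, indices, ...
labelRejected : Term 8
labelRejected =
  if v₀
  then let′ (hd v₀) (rejected 7F 7F 3F 0F (block (var 4F)) (copies₁ (var 4F)) (copies₁ (var 4F)))
  else nil′

-- The result consists of the labelled columns from the first accepted one on, hence is `nil`
-- exactly if the current column opens a new class.
findLabel : Term 7
findLabel = from labels (var 2F) while labelRejected step tl v₀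

-- Environment: image of i, result of findLabel, result of findImage, i, state, ...
-- Only the first column of a class is labelled: the labels of a class add up,
-- so that several labels could not be recovered from their sum.
relabel : Term 9
relabel =
  if var 1F
  then labels (var 4F) ∙′ copies₁ (var 4F) ∙′ copies₂ (var 4F) ∙′ block (var 4F)
  else ((var 3F ∙′ labels (var 4F)) ∙′
        copiesOnto 3F (block (var 4F)) (copies₁ (var 4F)) ∙′
        copiesOnto 0F (block (var 4F)) (copies₂ (var 4F)) ∙′
        reverseOnto (var 5F) (block (var 4F)))

stage : Term 5
stage =
  let′ (hd (todo v₀))
  (let′ findImage
  (let′ findLabel
  (let′ (hd (tl (var 1F)))
  (tl (todo (var 4F)) ∙′ reverseOnto (hd (var 2F)) (tl (tl (var 2F))) ∙′ (v₀ ∙′ images (var 4F)) ∙′ relabel))))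

-- The last column takes the remaining image without a query, which could
-- exceed the length bound.
searchPermutation : Program
searchPermutation =
  let′ (reverseOnto (hd v₀) nil′)
  (let′ (reverseOnto (tl (var 1F)) nil′)
  (let′ (descendingIndices (hd (hd (var 2F))))
  -- The n indices serve as columns, as images and as the counter for label 1, which receives n
  -- copies. The loop runs as long as two images are left.
  (let′ (from v₀ ∙′ v₀ ∙′ nil′ ∙′ nil′ ∙′ nil′ ∙′ nil′ ∙′ v₀ while tl (unused v₀) step stage)
  (hd (unused v₀) ∙′ images v₀))))

reflects-true : ∀ {P : Set} {b} → Reflects P b → P → b ≡ true
reflects-true (ofʸ _)  _ = refl
reflects-true (ofⁿ ¬p) p = ⊥-elim (¬p p)

module _ {A : Set} {n : ℕ} (x : A) (xs : List A) (l<n : suc (length xs) < n) where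

  private
    l : ℕ
    l = suc (length xs)

    triangle≤ : l * suc l ≤ n * n
    triangle≤ = *-mono-≤ (<⇒≤ l<n) l<n

  2*length-blocks≤ : length (blocks n (x ∷ xs)) * 2 ≤ n * (n * n)
  2*length-blocks≤ = ≤-trans (≤-reflexive (length-blocks n (x ∷ xs))) (*-monoʳ-≤ n triangle≤)

  -- With fewer than n labels, twice the number of copies is at most n³, and 2n ≤ n² because n ≥ 2.
  -- A label n would make the length exceed the bound by n.
  length-blocks+n≤ : length (reverse (blocks n (x ∷ xs))) + n ≤ n ^ 2 * (n + 1) / 2
  length-blocks+n≤ = subst (_≤ n ^ 2 * (n + 1) / 2) (m*n/n≡m _ 2) (/-monoˡ-≤ 2 (begin
    (length (reverse (blocks n (x ∷ xs))) + n) * 2   ≡⟨ cong (λ m → (m + n) * 2) (length-reverse (blocks n (x ∷ xs))) ⟩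
    (length (blocks n (x ∷ xs)) + n) * 2             ≡⟨ *-distribʳ-+ 2 (length (blocks n (x ∷ xs))) n ⟩
    length (blocks n (x ∷ xs)) * 2 + n * 2           ≤⟨ +-mono-≤ 2*length-blocks≤ (*-monoʳ-≤ n (≤-trans (s≤s (s≤s z≤n)) l<n)) ⟩
    n * (n * n) + n * n                              ≡⟨ cong (_+ n * n) (*-assoc n n n) ⟨
    n * n * n + n * n                                ≡⟨ cong (n * n * n +_) (*-identityʳ (n * n)) ⟨
    n * n * n + n * n * 1                            ≡⟨ *-distribˡ-+ (n * n) n 1 ⟨
    n * n * (n + 1)                                  ≡⟨ cong (λ m → n * m * (n + 1)) (*-identityʳ n) ⟨
    n ^ 2 * (n + 1)                                  ∎))
    where open ≤-Reasoning

false≢true : false ≢ true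
false≢true ()

-- Abstract, because the unifier would otherwise unfold powers with this exponent.
abstract
  exponent : ℕ
  exponent = 52

  52≤exponent : 52 ≤ exponent
  52≤exponent = ≤-refl

-- Correctness of the search

module Search (F : FiniteField) (O : Semantics.Oracle F) (decides : Semantics.DecidesLCE F O)
  {n k : ℕ} (G₁ G₂ : Semantics.Matrix F k n)
  (dim₁ : Semantics.HasDimension F k (Semantics.⟨_⟩ F G₁))
  (dim₂ : Semantics.HasDimension F k (Semantics.⟨_⟩ F G₂))
  (N : ℕ) (3≤N : 3 ≤ N) (n<N : n < N) (k<N : k < N) where

  open FiniteField F using (0#; _≈_; setoid)
  open Setoid setoid using () renaming (refl to ≈-refl; trans to ≈-trans)
  open Semantics F
  open CodeProperties F
  open QueryProperties F
  open CostedSemantics F O (IsLCEInstance k (n ^ 2 * (n + 1) / 2)) N 3≤N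

  Label : Set
  Label = Fin n × Fin n

  -- Every original column survives, so the repetition creates no linear dependency among the rows
  -- of the basis.
  hasDimension-repeatColumns : ∀ {A : Set} (f : A → Fin n) zs {G : Matrix k n} →
    HasDimension k ⟨ G ⟩ → HasDimension k ⟨ repeatColumns f zs G ⟩
  hasDimension-repeatColumns f zs {G} (B , independent , G⊆B , B⊆G) =
    repeatColumns f zs B , independent′ , transfer G B G⊆B , transfer B G B⊆G
    where
    independent′ : LinearlyIndependent (repeatColumns f zs B)
    independent′ a a≈0 = independent a λ j →
      subst (λ i → combination a B i ≈ 0#) (position-↑ʳ f zs j) (a≈0 (length zs ↑ʳ j))

    transfer : (C D : Matrix k n) → (∀ {x} → ⟨ C ⟩ x → ⟨ D ⟩ x) →
      ∀ {x} → ⟨ repeatColumns f zs C ⟩ x → ⟨ repeatColumns f zs D ⟩ x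
    transfer C D C⊆D (a , x≈) with b , aC≈bD ← C⊆D (a , λ _ → ≈-refl) =
      b , λ p → ≈-trans (x≈ p) (aC≈bD (position f zs p))

  query : (G H : Matrix k n) → Label → List Label → Tree
  query G H z L = encodePair (repeatColumns proj₁ (labelledCopies (z ∷ L)) G)
                             (repeatColumns proj₂ (labelledCopies (z ∷ L)) H)

  Linked : ∀ {G H : Matrix k n} → Equivalence G H → Label → Set
  Linked {H = H} E (r , s) = Proportional H s (permutation E ⟨$⟩ʳ r)

  SeparatedColumns : Matrix k n → List (Fin n) → Set
  SeparatedColumns G = Separation.Separated (columns G)

  module _ {G H : Matrix k n} (dimG : HasDimension k ⟨ G ⟩) (dimH : HasDimension k ⟨ H ⟩)
           (z : Label) (L : List Label) where

    private
      zs = labelledCopies (z ∷ L)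
      G⁺ = repeatColumns proj₁ zs G
      H⁺ = repeatColumns proj₂ zs H

      decision : Reflects (LinearlyEquivalent ⟨ G⁺ ⟩ ⟨ H⁺ ⟩) (O (query G H z L))
      decision = decides G⁺ H⁺ (hasDimension-repeatColumns proj₁ zs {G} dimG) (hasDimension-repeatColumns proj₂ zs {H} dimH)

    accepted : (E : Equivalence G H) → All (Linked E) (z ∷ L) → O (query G H z L) ≡ true
    accepted E linked = reflects-true decision (toLinearlyEquivalent (complete G H L z E linked))

    equivalence : O (query G H z L) ≡ true →
      SeparatedColumns G (map proj₁ L) → SeparatedColumns H (map proj₂ L) →
      Σ[ E ∈ Equivalence G H ] All (Linked E) (z ∷ L)
    equivalence eq sepG sepH = sound G H L z sepG sepH
      (fromLinearlyEquivalent G⁺ H⁺ (invert (subst (Reflects _) eq decision)))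

    query-instance : suc (length L) < n → IsLCEInstance k (n ^ 2 * (n + 1) / 2) (query G H z L)
    query-instance l<n = length zs + n , length-blocks+n≤ z L l<n , G⁺ , H⁺ ,
      hasDimension-repeatColumns proj₁ zs {G} dimG , hasDimension-repeatColumns proj₂ zs {H} dimH , refl

  n²<N² : n * n < N * N
  n²<N² = *-mono-< n<N n<N

  block-length : ∀ {l} → l < n → n * suc l < N ^ 3
  block-length {l} l<n = begin-strict
    n * suc l  ≤⟨ *-monoʳ-≤ n l<n ⟩
    n * n      <⟨ n²<N² ⟩
    N * N      ≡⟨ cong (N *_) (*-identityʳ N) ⟨
    N ^ 2      ≤⟨ ^-monoʳ-≤ N (n≤1+n 2) ⟩
    N ^ 3      ∎
    where open ≤-Reasoning

  copies-length : ∀ (z : Label) L → suc (length L) < n → length (blocks n (z ∷ L)) < N ^ 4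
  copies-length z L l<n = begin-strict
    length (blocks n (z ∷ L))      ≤⟨ m≤m*n _ 2 ⟩
    length (blocks n (z ∷ L)) * 2  ≤⟨ 2*length-blocks≤ z L l<n ⟩
    n * (n * n)                    <⟨ *-mono-< n<N n²<N² ⟩
    N * (N * N)                    ≡⟨ cong (λ m → N * (N * m)) (*-identityʳ N) ⟨
    N ^ 3                          ≤⟨ ^-monoʳ-≤ N (n≤1+n 3) ⟩
    N ^ 4                          ∎
    where open ≤-Reasoning

  answer : Bool → Tree
  answer true  = nil
  answer false = nil ∙ nil

  module _ {m} {ρ : Environment m} where

    extended-ev′ : ∀ {G : Matrix k n} (f : Label → Fin n) z L bs {g i b e} → suc (length L) < n →
      length bs ≡ n * suc (length L) →
      lookup ρ g ≡ reversedRows G → lookup ρ i ≡ index (f z) →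
      Evaluates ρ b (toTree bs) 6 0 → Evaluates ρ e (indices (blocks n (map f L))) 6 0 →
      Evaluates ρ (extended g i b e) (encodeMatrix (repeatColumns f (reverse (blocks n (z ∷ L))) G)) 25 0
    extended-ev′ {G} f z L bs l<n bs≡ g≡ i≡ bev eev =
      resp (cong (λ m → encodeMatrix (repeatColumns f (reverse (replicate m z ++ blocks n L)) G)) bs≡)
        (extended-ev {f = f} {z} {blocks n L} {bs} k<N n<N
          (subst (_< N ^ 3) (sym bs≡) (block-length (<-trans (n<1+n _) l<n)))
          (subst (λ m → length (replicate m z ++ blocks n L) < N ^ 4) (sym bs≡) (copies-length z L l<n))
          g≡ i≡ (weaken (m≤m+n 6 4) bev)
          (weaken (m≤m+n 6 4) (resp (cong indices (sym (map-blocks f n L))) eev)))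

    answer-ev : ∀ {s e} b → Evaluates ρ s (bool b) e 1 →
      Evaluates ρ (if s then nil′ else (nil′ ∙′ nil′)) (answer b) (suc (e ⊔ 1)) 1
    answer-ev {e = e} true  r = weaken (s≤s (⊔-monoʳ-≤ e z≤n)) (true-ev r (λ ()) nil-ev)
    answer-ev         false r = false-ev r (straight (nil′ ∙′ nil′))

    rejected-ev : ∀ {G H} (dimG : HasDimension k ⟨ G ⟩) (dimH : HasDimension k ⟨ H ⟩) z L bs {g h i j b c d} →
      suc (length L) < n → length bs ≡ n * suc (length L) →
      lookup ρ g ≡ reversedRows G → lookup ρ h ≡ reversedRows H →
      lookup ρ i ≡ index (proj₁ z) → lookup ρ j ≡ index (proj₂ z) →
      Evaluates ρ b (toTree bs) 6 0 →
      Evaluates ρ c (indices (blocks n (map proj₁ L))) 6 0 →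
      Evaluates ρ d (indices (blocks n (map proj₂ L))) 6 0 →
      Evaluates ρ (rejected g h i j b c d) (answer (O (query G H z L))) 28 1
    rejected-ev {G} {H} dimG dimH z L bs l<n bs≡ g≡ h≡ i≡ j≡ bev cev dev =
      answer-ev (O (query G H z L))
        (ask-ev (cons-ev (extended-ev′ {G = G} proj₁ z L bs l<n bs≡ g≡ i≡ bev cev)
                         (extended-ev′ {G = H} proj₂ z L bs l<n bs≡ h≡ j≡ bev dev))
                (query-instance {G} {H} dimG dimH z L l<n))

  _≼_ : Label → Label → Set
  (i , j) ≼ (r , s) = Proportional G₁ i r × Proportional G₂ j s

  -- Why one label per class suffices: an equivalence permutes the classes, so respecting the
  -- labelled pair settles where the whole class goes.
  linked-resp : ∀ (E : Equivalence G₁ G₂) {y z} → Linked E y → z ≼ y → Linked E z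
  linked-resp E linked (i~r , j~s) = proportional-trans G₂ j~s
    (proportional-trans G₂ linked (permutation-cong E (proportional-sym G₁ i~r)))

  -- T, U and D are the columns still to be mapped, the images still unused
  -- and the assignments made so far, in increasing order of the column.  L
  -- keeps one assignment from each class met so far.
  record Invariant (T U : List (Fin n)) (D L : List Label) : Set₁ where
    field
      todo-done : T ʳ++ map proj₁ D ≡ allFin n
      used      : map proj₂ D ++ U ↭ allFin n
      equiv     : Equivalence G₁ G₂
      linked    : All (Linked equiv) L
      covered   : All (λ z → Any (z ≼_) L) D
      separated : SeparatedColumns G₁ (map proj₁ L)
      shorter   : length L ≤ length D

    linked-covered : ∀ {z} → Any (z ≼_) L → Linked equiv z
    linked-covered p with y , y∈L , z≼y ← find p = linked-resp equiv (All.lookup linked y∈L) z≼y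

    linkedᴰ : All (Linked equiv) D
    linkedᴰ = All.map linked-covered covered

    length-todo : length T + length D ≡ n
    length-todo = begin
      length T + length D                          ≡⟨ cong (length T +_) (length-map proj₁ D) ⟨
      length T + length (map proj₁ D)         ≡⟨ length-++ T ⟨
      length (T ++ map proj₁ D)               ≡⟨ ↭-length (++↭ʳ++ T (map proj₁ D)) ⟩
      length (T ʳ++ map proj₁ D)              ≡⟨ cong length todo-done ⟩
      length (allFin n)                            ≡⟨ length-tabulate id ⟩
      n                                            ∎
      where open ≡-Reasoning

    length-unused : length U + length D ≡ n
    length-unused = begin
      length U + length D                      ≡⟨ +-comm (length U) (length D) ⟩
      length D + length U                      ≡⟨ cong (_+ length U) (length-map proj₂ D) ⟨
      length (map proj₂ D) + length U     ≡⟨ length-++ (map proj₂ D) ⟨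
      length (map proj₂ D ++ U)           ≡⟨ ↭-length used ⟩
      length (allFin n)                        ≡⟨ length-tabulate id ⟩
      n                                        ∎
      where open ≡-Reasoning

    -- `sound` asks for separation on both sides, while the invariant stores one; an equivalence is
    -- injective on classes.
    separated₂ : SeparatedColumns G₂ (map proj₂ L)
    separated₂ = transfer linked separated
      where
      transferAll : ∀ {r s L} → Linked equiv (r , s) → All (Linked equiv) L →
        All (λ r′ → ¬ Proportional G₁ r r′) (map proj₁ L) → All (λ s′ → ¬ Proportional G₂ s s′) (map proj₂ L)
      transferAll lk []         []        = []
      transferAll lk (l′ ∷ ls) (¬p ∷ ¬ps) =
        (λ s~s′ → ¬p (permutation-injective equiv (proportional-trans G₂ (proportional-sym G₂ lk)
          (proportional-trans G₂ s~s′ l′)))) ∷ transferAll lk ls ¬ps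

      transfer : ∀ {L} → All (Linked equiv) L →
        SeparatedColumns G₁ (map proj₁ L) → SeparatedColumns G₂ (map proj₂ L)
      transfer []       []         = []
      transfer (l ∷ ls) (¬ps ∷ sep) = transferAll l ls ¬ps ∷ transfer ls sep

  available : ∀ {i T U D L} (I : Invariant (i ∷ T) U D L) → let open Invariant I in
    Any (λ j → Linked equiv (i , j)) U
  available {i} {T} {U} {D} I = Any.map (λ e → proportional-sym G₂ (~ᵇ⇒~ e))
    (count-positive p U (subst (0 <_) same-count (count-positive⁺ p (σ i) (map σ T) (~ᵇ-refl (σ i)))))
    where
    open Invariant I
    open Separation (columns G₂) using (_~ᵇ_; ~ᵇ-refl; ~ᵇ⇒~; ~ᵇ-congʳ)
    open ≡-Reasoning
    σ = permutation equiv ⟨$⟩ʳ_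
    p = σ i ~ᵇ_

    same-count : count p (map σ (i ∷ T)) ≡ count p U
    same-count = +-cancelʳ-≡ (count p (map σ (map proj₁ D))) _ _ (begin
      count p (map σ (i ∷ T)) + count p (map σ (map proj₁ D))
        ≡⟨ cong₂ _+_ (count-map p σ (i ∷ T)) (count-map p σ (map proj₁ D)) ⟩
      count (p ∘ σ) (i ∷ T) + count (p ∘ σ) (map proj₁ D)
        ≡⟨ count-++ (p ∘ σ) (i ∷ T) (map proj₁ D) ⟨
      count (p ∘ σ) ((i ∷ T) ++ map proj₁ D)
        ≡⟨ count-↭ (p ∘ σ) (++↭ʳ++ (i ∷ T) (map proj₁ D)) ⟩
      count (p ∘ σ) ((i ∷ T) ʳ++ map proj₁ D)   ≡⟨ cong (count (p ∘ σ)) todo-done ⟩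
      count (p ∘ σ) (allFin n)                       ≡⟨ count-tabulate-cong (p ∘ σ) p id σ (λ _ → refl) ⟩
      count p (tabulate σ)                           ≡⟨ count-tabulate-permute p id (permutation equiv) ⟩
      count p (allFin n)                             ≡⟨ count-↭ p used ⟨
      count p (map proj₂ D ++ U)                ≡⟨ count-++ p (map proj₂ D) U ⟩
      count p (map proj₂ D) + count p U         ≡⟨ +-comm (count p (map proj₂ D)) _ ⟩
      count p U + count p (map proj₂ D)
        ≡⟨ cong (count p U +_) (count-map-cong p p proj₂ (σ ∘ proj₁) (~ᵇ-congʳ (σ i)) linkedᴰ) ⟩
      count p U + count p (map (σ ∘ proj₁) D)   ≡⟨ cong (λ xs → count p U + count p xs) (map-∘ D) ⟩
      count p U + count p (map σ (map proj₁ D)) ∎)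

  state : (T U : List (Fin n)) (D L : List Label) → List Tree → Tree
  state T U D L bs = indices T ∙ indices U ∙ indices (map proj₂ D) ∙ indices (map proj₁ L) ∙
    indices (blocks n (map proj₁ L)) ∙ indices (blocks n (map proj₂ L)) ∙ toTree bs

  accepts : Fin n → List Label → Fin n → Bool
  accepts i L j = O (query G₁ G₂ (i , j) L)

  diagonal : Label → Label
  diagonal z = proj₁ z , proj₁ z

  -- Asked of G₁ and itself, the query tells whether i is proportional to the
  -- labelled column r.
  repeats : Fin n → List Label → Fin n → Bool
  repeats i L r = O (query G₁ G₁ (i , r) (map diagonal L))

  module _ (i : Fin n) (T U : List (Fin n)) (D L : List Label) (bs : List Tree)
           (l<n : suc (length L) < n) (bs≡ : length bs ≡ n * suc (length L))
           (input : Tree) where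

    private
      st : Tree
      st = state (i ∷ T) U D L bs

      ρ₆ : Environment 6
      ρ₆ = index i ∷ᵛ st ∷ᵛ indices (reverse (allFin n)) ∷ᵛ reversedRows G₂ ∷ᵛ reversedRows G₁ ∷ᵛ input ∷ᵛ []ᵛ

    findImage-cond : ∀ (j : Fin n) (W V : List (Fin n)) →
      Evaluates ((indices W ∙ indices (j ∷ V)) ∷ᵛ ρ₆) imageRejected (answer (accepts i L j)) 29 1
    findImage-cond j W V = let-ev (straight (hd (tl v₀)))
      (rejected-ev {G = G₁} {G₂} dim₁ dim₂ (i , j) L bs l<n bs≡ refl refl refl refl
        (straight (block (var 3F))) (weaken (n≤1+n 5) (straight (copies₁ (var 3F)))) (straight (copies₂ (var 3F))))

    record ImageFound (W V : List (Fin n)) : Set where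
      constructor imageFound
      field
        {before}  : List (Fin n)
        {found}   : Fin n
        {after}   : List (Fin n)
        splitting : before ʳ++ (found ∷ after) ≡ W ʳ++ V
        isImage   : accepts i L found ≡ true
        loops     : Loops ρ₆ imageRejected ((hd (tl v₀) ∙′ hd v₀) ∙′ tl (tl v₀))
          (indices W ∙ indices V) (indices before ∙ indices (found ∷ after)) (length V) 30 (length V)

    findImage-loops : ∀ W V → Any (λ j → accepts i L j ≡ true) V → ImageFound W V
    findImage-loops W (j ∷ V) any = decide (accepts i L j) refl (findImage-cond j W V)
      where
      decide : ∀ b → accepts i L j ≡ b →
        Evaluates ((indices W ∙ indices (j ∷ V)) ∷ᵛ ρ₆) imageRejected (answer b) 29 1 → ImageFound W (j ∷ V)
      decide true  eq e = imageFound {before = W} {j} {V} refl eq (weaken-loops (s≤s z≤n) (s≤s z≤n) (stop-ev e))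
      decide false eq e
        with imageFound {W′} {j′} {V′} same eq′ loops ←
          findImage-loops (j ∷ W) V (Any.tail (λ eq′ → false≢true (trans (sym eq) eq′)) any) =
        imageFound {before = W′} {j′} {V′} same eq′
        (next-ev e (λ ()) (weaken (m≤m+n 4 25) (straight ((hd (tl v₀) ∙′ hd v₀) ∙′ tl (tl v₀)))) loops)

    module _ (c : Tree) where

      findLabel-cond : ∀ (r : Fin n) (M : List (Fin n)) → Evaluates (indices (r ∷ M) ∷ᵛ c ∷ᵛ ρ₆) labelRejected (answer (repeats i L r)) 30 1
      findLabel-cond r M = true-ev (variable′ 0F) (λ ()) (let-ev (straight (hd v₀))
        (rejected-ev {G = G₁} {G₁} dim₁ dim₁ (i , r) (map diagonal L) bs
          (subst (λ l → suc l < n) (sym (length-map diagonal L)) l<n)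
          (trans bs≡ (cong (λ l → n * suc l) (sym (length-map diagonal L))))
          refl refl refl refl (straight (block (var 4F))) (firsts (map-∘ L)) (firsts (map-∘ L))))
        where
        firsts : ∀ {xs} → map proj₁ L ≡ xs →
          Evaluates (index r ∷ᵛ indices (r ∷ M) ∷ᵛ c ∷ᵛ ρ₆) (copies₁ (var 4F)) (indices (blocks n xs)) 6 0
        firsts refl = weaken (n≤1+n 5) (straight (copies₁ (var 4F)))

      record LabelSought (M : List (Fin n)) : Set where
        constructor labelSought
        field
          {remaining} : List (Fin n)
          loops       : Loops (c ∷ᵛ ρ₆) labelRejected (tl v₀)
            (indices M) (indices remaining) (suc (length M)) 31 (length M)
          outcome     : (remaining ≡ [] × All (λ r → repeats i L r ≡ false) M) ⊎
                        (indices remaining ≢ nil × Any (λ r → repeats i L r ≡ true) M)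

      findLabel-loops : ∀ M → LabelSought M
      findLabel-loops []      = labelSought {remaining = []}
        (stop-ev (weaken (m≤m+n 1 29) (false-ev (variable′ 0F) nil-ev))) (inj₁ (refl , []))
      findLabel-loops (r ∷ M) = decide (repeats i L r) refl (findLabel-cond r M)
        where
        decide : ∀ b → repeats i L r ≡ b →
          Evaluates (indices (r ∷ M) ∷ᵛ c ∷ᵛ ρ₆) labelRejected (answer b) 30 1 → LabelSought (r ∷ M)
        decide true  eq e = labelSought {remaining = r ∷ M}
          (weaken-loops (s≤s z≤n) (s≤s z≤n) (stop-ev e)) (inj₂ ((λ ()) , here eq))
        decide false eq e with labelSought {M′} loops outcome ← findLabel-loops M =
          labelSought {remaining = M′} (next-ev e (λ ()) (weaken (m≤m+n 1 29) (straight (tl v₀))) loops)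
            (Sum.map (λ (M′≡ , all) → M′≡ , eq ∷ all) (λ (M′≢ , any) → M′≢ , there any) outcome)

  module _ {i : Fin n} {T U : List (Fin n)} {D L : List Label} (I : Invariant (i ∷ T) U D L) where
    open Invariant I

    -- The diagonal labels force `E` to map the class of each labelled column to itself. Since `i`
    -- is sent into the class of the tested column as well, injectivity on classes applies.
    repeats-sound : ∀ {y} → y ∈ L → repeats i L (proj₁ y) ≡ true → Proportional G₁ i (proj₁ y)
    repeats-sound {y} y∈L eq = conclude (equivalence {G₁} {G₁} dim₁ dim₁ (i , proj₁ y) (map diagonal L) eq (separated′ (map-∘ L)) (separated′ (map-∘ L)))
      where
      separated′ : ∀ {xs} → map proj₁ L ≡ xs → SeparatedColumns G₁ xs
      separated′ refl = separated

      conclude : Σ[ E ∈ Equivalence G₁ G₁ ] All (Linked E) ((i , proj₁ y) ∷ map diagonal L) →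
        Proportional G₁ i (proj₁ y)
      conclude (E , i↦r ∷ others) = permutation-injective E (proportional-trans G₁ (proportional-sym G₁ i↦r) fixed)
        where
        fixed : Linked E (diagonal y)
        fixed = All.lookup (All.map⁻ {f = diagonal} others) y∈L

    -- For proportional columns the identity respects all labels, so the query would be accepted.
    repeats-complete : ∀ {r} → repeats i L r ≡ false → ¬ Proportional G₁ i r
    repeats-complete {r} eq i~r = false≢true (trans (sym eq)
      (accepted {G₁} {G₁} dim₁ dim₁ (i , r) (map diagonal L) (identity G₁)
        (proportional-sym G₁ i~r ∷ All.map⁺ (All.universal (λ y → proportional-refl G₁) L))))

    module _ (W V : List (Fin n)) {j : Fin n} (splits : W ʳ++ (j ∷ V) ≡ U)
             (E : Equivalence G₁ G₂) (linked′ : All (Linked E) ((i , j) ∷ L)) where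

      used′ : j ∷ map proj₂ D ++ (W ʳ++ V) ↭ allFin n
      used′ = ↭-trans (↭-sym (shift j (map proj₂ D) (W ʳ++ V))) (↭-trans (++⁺ˡ (map proj₂ D)
        (↭-trans (prep j (↭-sym (++↭ʳ++ W V))) (↭-trans (↭-sym (shift j W V))
          (↭-trans (++↭ʳ++ W (j ∷ V)) (↭-reflexive splits))))) used)

      -- The new equivalence sends the labelled column of the class to its recorded image and `i` to
      -- `j`, each up to proportionality; both images therefore share a class, and the old label
      -- covers `(i , j)`.
      invariant-old : Any (λ y → Proportional G₁ i (proj₁ y)) L → Invariant T (W ʳ++ V) ((i , j) ∷ D) L
      invariant-old old = record
        { todo-done = todo-done
        ; used      = used′
        ; equiv     = E
        ; linked    = All.tail linked′
        ; covered   = covers old ∷ covered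
        ; separated = separated
        ; shorter   = m≤n⇒m≤1+n shorter }
        where
        covers : Any (λ y → Proportional G₁ i (proj₁ y)) L → Any ((i , j) ≼_) L
        covers p with y , y∈L , i~r ← find p = lose y∈L (i~r ,
          proportional-trans G₂ (All.head linked′) (proportional-trans G₂ (permutation-cong E i~r)
            (proportional-sym G₂ (All.lookup (All.tail linked′) y∈L))))

      invariant-new : All (λ y → ¬ Proportional G₁ i (proj₁ y)) L →
        Invariant T (W ʳ++ V) ((i , j) ∷ D) ((i , j) ∷ L)
      invariant-new new = record
        { todo-done = todo-done
        ; used      = used′
        ; equiv     = E
        ; linked    = linked′
        ; covered   = here (proportional-refl G₁ , proportional-refl G₂) ∷ All.map there covered
        ; separated = All.map⁺ new ∷ separated
        ; shorter   = s≤s shorter }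

  record Staged (i : Fin n) (T U : List (Fin n)) (D L : List Label) (bs : List Tree) (input : Tree) : Set₁ where
    constructor staged
    field
      {unused′}    : List (Fin n)
      {target}     : Fin n
      {labels′}    : List Label
      {block′}     : List Tree
      invariant    : Invariant T unused′ ((i , target) ∷ D) labels′
      block-size   : length block′ ≡ n * suc (length labels′)
      evaluates    : Evaluates (state (i ∷ T) U D L bs ∷ᵛ indices (reverse (allFin n)) ∷ᵛ
                                reversedRows G₂ ∷ᵛ reversedRows G₁ ∷ᵛ input ∷ᵛ []ᵛ)
                       stage (state T unused′ ((i , target) ∷ D) labels′ block′) 45 n

  stage-ev : ∀ {i T U D L} bs input → Invariant (i ∷ T) U D L → suc (length L) < n →
    length bs ≡ n * suc (length L) → Staged i T U D L bs input
  stage-ev {i} {T} {U} {D} {L} bs input I l<n bs≡ = assemble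
    (findImage-loops i T U D L bs l<n bs≡ input [] U
      (Any.map (λ lk → accepted {G₁} {G₂} dim₁ dim₂ _ L equiv (lk ∷ linked)) (available I)))
    where
    open Invariant I

    ρ₅ : Environment 5
    ρ₅ = state (i ∷ T) U D L bs ∷ᵛ indices (reverse (allFin n)) ∷ᵛ
         reversedRows G₂ ∷ᵛ reversedRows G₁ ∷ᵛ input ∷ᵛ []ᵛ

    U≤n : length U ≤ n
    U≤n = subst (length U ≤_) length-unused (m≤m+n (length U) (length D))

    L≤n : length (map proj₁ L) ≤ n
    L≤n = ≤-trans (≤-reflexive (length-map proj₁ L)) (<⇒≤ (<-trans (n<1+n _) l<n))

    N≤N¹ : N ≤ N ^ 1
    N≤N¹ = ≤-reflexive (sym (^-identityʳ N))

    -- There are no more labels than assignments, and each assignment has used up one image.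
    queries≤n : length U + (length (map proj₁ L) + 0) ≤ n
    queries≤n = begin
      length U + (length (map proj₁ L) + 0)  ≡⟨ cong (length U +_) (+-identityʳ _) ⟩
      length U + length (map proj₁ L)        ≡⟨ cong (length U +_) (length-map proj₁ L) ⟩
      length U + length L                         ≤⟨ +-monoʳ-≤ (length U) shorter ⟩
      length U + length D                         ≡⟨ length-unused ⟩
      n                                           ∎
      where open ≤-Reasoning

    assemble : ImageFound i T U D L bs l<n bs≡ input [] U → Staged i T U D L bs input
    assemble (imageFound {W} {j} {V} splits isImage loops) = finish
      (equivalence {G₁} {G₂} dim₁ dim₂ (i , j) L isImage separated separated₂)
      (findLabel-loops i T U D L bs l<n bs≡ input c (map proj₁ L))
      where
      c : Tree
      c = indices W ∙ indices (j ∷ V)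

      ρ₉ : Tree → Environment 9
      ρ₉ f = index j ∷ᵛ f ∷ᵛ c ∷ᵛ index i ∷ᵛ ρ₅

      W<N : length W < N
      W<N = ≤-<-trans (begin
        length W                     ≤⟨ m≤m+n (length W) _ ⟩
        length W + suc (length V)    ≡⟨ length-ʳ++ W ⟨
        length (W ʳ++ (j ∷ V))       ≡⟨ cong length splits ⟩
        length U                     ≤⟨ U≤n ⟩
        n                            ∎) n<N
        where open ≤-Reasoning

      block<N³ : length bs < N ^ 3
      block<N³ = subst (_< N ^ 3) (sym bs≡) (block-length (<-trans (n<1+n _) l<n))

      wrap : ∀ {M : List (Fin n)} {u} → Loops (c ∷ᵛ index i ∷ᵛ ρ₅) labelRejected (tl v₀) (indices (map proj₁ L)) (indices M)
          (suc (length (map proj₁ L))) 31 (length (map proj₁ L)) →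
        Evaluates (ρ₉ (indices M)) relabel u 20 0 →
        Evaluates ρ₅ stage (indices T ∙ indices (W ʳ++ V) ∙ indices (j ∷ map proj₂ D) ∙ u) 45 n
      wrap loops′ ev = weaken-queries queries≤n (weaken (m≤m+n 36 9)
        (let-ev (straight (hd (todo v₀)))
        (let-ev (loop-ev 1 (cons-ev nil-ev (straight (unused (var 1F)))) loops
          (≤-trans U≤n (≤-trans (<⇒≤ n<N) N≤N¹)))
        (let-ev (loop-ev 1 (straight (labels (var 2F))) loops′ (≤-trans (s≤s L≤n) (≤-trans n<N N≤N¹)))
        (let-ev (straight (hd (tl (var 1F))))
        (cons-ev (straight (tl (todo (var 4F))))
        (cons-ev (resp (cong toTree (sym (map-ʳ++ index W)))
          (reverseOnto-ev {xs = map index W} {map index V}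
            (subst (_< N) (sym (length-map index W)) W<N) (straight (hd (var 2F))) (straight (tl (tl (var 2F))))))
        (cons-ev (straight (v₀ ∙′ images (var 4F))) ev))))))))

      copied : ∀ (x : Fin n) xs → length xs ≡ length L →
        toTree (replicate (length bs) (index x) ++ map index (blocks n xs)) ≡ indices (blocks n (x ∷ xs))
      copied x xs xs≡ = cong toTree (begin
        replicate (length bs) (index x) ++ map index (blocks n xs)
          ≡⟨ cong (λ m → replicate m (index x) ++ map index (blocks n xs)) (trans bs≡ (cong (λ l → n * suc l) (sym xs≡))) ⟩
        replicate (n * suc (length xs)) (index x) ++ map index (blocks n xs)
          ≡⟨ cong (_++ map index (blocks n xs)) (map-replicate index (n * suc (length xs)) x) ⟨
        map index (replicate (n * suc (length xs)) x) ++ map index (blocks n xs)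
          ≡⟨ map-++ index (replicate (n * suc (length xs)) x) (blocks n xs) ⟨
        map index (blocks n (x ∷ xs)) ∎)
        where open ≡-Reasoning

      finish : Σ[ E ∈ Equivalence G₁ G₂ ] All (Linked E) ((i , j) ∷ L) →
        LabelSought i T U D L bs l<n bs≡ input c (map proj₁ L) →
        Staged i T U D L bs input
      finish (E , linked′) (labelSought loops′ (inj₁ (refl , none))) = staged
        -- Prepending n further entries raises the counter from n times one label to n times the
        -- next.
        {block′ = map index (reverse (allFin n)) ʳ++ bs}
        (invariant-new I W V splits E linked′ (All.map (repeats-complete I) (All.map⁻ none)))
        (begin
          length (map index (reverse (allFin n)) ʳ++ bs)     ≡⟨ length-ʳ++ (map index (reverse (allFin n))) ⟩
          length (map index (reverse (allFin n))) + length bs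
            ≡⟨ cong₂ _+_ (trans (length-map index (reverse (allFin n))) length-columns) bs≡ ⟩
          n + n * suc (length L)                                  ≡⟨ *-suc n (suc (length L)) ⟨
          n * suc (suc (length L))                                ∎)
        (wrap {[]} loops′ (weaken (m≤m+n 13 7) (false-ev (variable′ 1F)
          (cons-ev (straight (var 3F ∙′ labels (var 4F)))
          (cons-ev (resp (copied i (map proj₁ L) (length-map proj₁ L))
            (copiesOnto-ev 3F {bs = bs} {map index (blocks n (map proj₁ L))} 3 block<N³
              (straight (block (var 4F))) (straight (copies₁ (var 4F)))))
          (cons-ev (resp (copied j (map proj₂ L) (length-map proj₂ L))
            (copiesOnto-ev 0F {bs = bs} {map index (blocks n (map proj₂ L))} 3 block<N³
              (straight (block (var 4F))) (straight (copies₂ (var 4F)))))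
          (reverseOnto-ev {xs = map index (reverse (allFin n))} {bs}
            (subst (_< N) (sym (trans (length-map index (reverse (allFin n))) length-columns)) n<N)
            (straight (var 5F)) (straight (block (var 4F))))))))))
        where
        open ≡-Reasoning
        length-columns : length (reverse (allFin n)) ≡ n
        length-columns = trans (length-reverse (allFin n)) (length-tabulate id)
      finish (E , linked′) (labelSought {M} loops′ (inj₂ (M≢nil , some))) = staged {block′ = bs}
        (invariant-old I W V splits E linked′ repeated-label)
        bs≡
        (wrap {M} loops′ (weaken (m≤m+n 10 10) (true-ev (variable′ 1F) M≢nil
          (straight (labels (var 4F) ∙′ copies₁ (var 4F) ∙′ copies₂ (var 4F) ∙′ block (var 4F))))))
        where
        repeated-label : Any (λ y → Proportional G₁ i (proj₁ y)) L
        repeated-label with y , y∈L , eq ← find (Any.map⁻ some) = lose y∈L (repeats-sound I y∈L eq)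

  columns↓ : List (Fin n)
  columns↓ = reverse (allFin n)

  length-columns↓ : length columns↓ ≡ n
  length-columns↓ = trans (length-reverse (allFin n)) (length-tabulate id)

  module _ (input : Tree) where

    ρ₄ : Environment 4
    ρ₄ = indices columns↓ ∷ᵛ reversedRows G₂ ∷ᵛ reversedRows G₁ ∷ᵛ input ∷ᵛ []ᵛ

    record Finished (T U : List (Fin n)) (D L : List Label) (bs : List Tree) : Set₁ where
      constructor finished
      field
        {lastColumn} : Fin n
        {lastImage}  : Fin n
        {assigned}   : List Label
        {labels′}    : List Label
        {block′}     : List Tree
        invariant    : Invariant (lastColumn ∷ []) (lastImage ∷ []) assigned labels′
        loops        : Loops ρ₄ (tl (unused v₀)) stage (state T U D L bs)
          (state (lastColumn ∷ []) (lastImage ∷ []) assigned labels′ block′)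
          (length T) 46 (length T * n)

    stages-loop : ∀ i T U D L bs → Invariant (i ∷ T) U D L → length bs ≡ n * suc (length L) →
      Finished (i ∷ T) U D L bs
    stages-loop i T U D L bs I bs≡ = go T U I
      (+-cancelʳ-≡ (length D) _ _ (trans (Invariant.length-unused I) (sym (Invariant.length-todo I))))
      where
      go : ∀ T U → Invariant (i ∷ T) U D L → length U ≡ suc (length T) → Finished (i ∷ T) U D L bs
      go [] (j ∷ []) I _ = finished {block′ = bs} I
        (weaken-loops ≤-refl z≤n (stop-ev (weaken (m≤m+n 3 42) (straight (tl (unused v₀))))))
      go (i′ ∷ T) (j ∷ j′ ∷ U) I _ = continue (stage-ev bs input I l<n bs≡)
        where
        -- Two columns are still unmapped, so at most n - 2 pairs carry labels and the next label
        -- stays below n.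
        l<n : suc (length L) < n
        l<n = begin
          2 + length L                  ≤⟨ +-monoʳ-≤ 2 (Invariant.shorter I) ⟩
          2 + length D                  ≤⟨ +-monoˡ-≤ (length D) (m≤m+n 2 (length T)) ⟩
          2 + length T + length D       ≡⟨ Invariant.length-todo I ⟩
          n                             ∎
          where open ≤-Reasoning

        continue : Staged i (i′ ∷ T) (j ∷ j′ ∷ U) D L bs input → Finished (i ∷ i′ ∷ T) (j ∷ j′ ∷ U) D L bs
        continue (staged {U′} {t} {L′} {bs′} I′ bs′≡ ev) with
          finished {block′ = bs″} I″ loops ← stages-loop i′ T U′ ((i , t) ∷ D) L′ bs′ I′ bs′≡ =
          finished {block′ = bs″} I″
            (next-ev (weaken (m≤m+n 3 42) (straight (tl (unused v₀)))) (λ ()) ev loops)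

  initial-invariant : Equivalence G₁ G₂ → Invariant columns↓ columns↓ [] []
  initial-invariant E = record
    { todo-done = reverse-involutive (allFin n)
    ; used      = ↭-reverse (allFin n)
    ; equiv     = E
    ; linked    = []
    ; covered   = []
    ; separated = []
    ; shorter   = z≤n }

  Solution : Set
  Solution = Σ[ π ∈ Permutation′ n ] Σ[ c ∈ ℕ ] Σ[ Q ∈ List Tree ]
    Runs O searchPermutation (encodePair G₁ G₂) (encodePermutation π) c Q
    × (Σ[ v ∈ Vector F* n ] image (π , v) ⟨ G₁ ⟩ ≐ ⟨ G₂ ⟩)
    × c ≤ 1 * N ^ exponent
    × length Q ≤ n ^ 2
    × All (IsLCEInstance k (n ^ 2 * (n + 1) / 2)) Q

  module _ {i j : Fin n} {D L : List Label} (I : Invariant (i ∷ []) (j ∷ []) D L) where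
    open Invariant I

    -- With one image left, the counting argument of `available` identifies it without a query.
    last-linked : Linked equiv (i , j)
    last-linked = Any.singleton⁻ (available I)

    table = functionTable id ((i , j) ∷ D) todo-done

    f : Fin n → Fin n
    f = proj₁ table

    images≡ : j ∷ map proj₂ D ≡ tabulate f
    images≡ = proj₁ (proj₂ table)

    private module Equal = Matching (Fin.≡-decSetoid n)

    found : Σ[ π ∈ Permutation′ n ] (∀ i → f i ≡ π ⟨$⟩ʳ i)
    found = Equal.matching f id λ x →
      trans (cong (count (x Equal.~ᵇ_)) (sym images≡))
        (count-↭ (x Equal.~ᵇ_) (↭-trans (∷↭∷ʳ j (map proj₂ D)) used))

    -- The permutation found may differ from that of `equiv`, but it sends each column into the same
    -- class, so the alignment carries over.
    assembled-isometry : Σ[ v ∈ Vector F* n ] image (proj₁ found , v) ⟨ G₁ ⟩ ≐ ⟨ G₂ ⟩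
    assembled-isometry = aligned⇒isometry (coupling equiv) G₁ G₂ (proj₁ found) λ i′ →
      aligned-respʳ (coupling equiv) G₁ G₂ (aligned equiv i′)
        (subst (λ j′ → Proportional G₂ (permutation equiv ⟨$⟩ʳ i′) j′) (proj₂ found i′)
          (proportional-sym G₂ (All.lookup (last-linked ∷ linkedᴰ) (proj₂ (proj₂ table) i′))))

    output≡ : indices (j ∷ map proj₂ D) ≡ encodePermutation (proj₁ found)
    output≡ = begin
      indices (j ∷ map proj₂ D)                          ≡⟨ cong indices images≡ ⟩
      toTree (map index (tabulate f))                    ≡⟨ cong toTree (map-tabulate f index) ⟩
      toTree (tabulate (index ∘ f))                           ≡⟨ cong toTree (tabulate-cong (cong index ∘ proj₂ found)) ⟩
      toTree (tabulate (λ i → index (proj₁ found ⟨$⟩ʳ i)))    ≡⟨ list≡toTree (λ i → index (proj₁ found ⟨$⟩ʳ i)) ⟨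
      encodePermutation (proj₁ found)                         ∎
      where open ≡-Reasoning

  reversedRows-ev : ∀ {m} {ρ : Environment m} {s e} (G : Matrix k n) → Evaluates ρ s (encodeMatrix G) e 0 →
    Evaluates ρ (reverseOnto s nil′) (reversedRows G) (2 + (suc (e ⊔ 0) ⊔ 6)) 0
  reversedRows-ev G sev = resp (cong toTree (trans (cong reverse (sym (map-tabulate id (encodeRow G))))
      (sym (reverse-map (encodeRow G) (allFin k)))))
    (reverseOnto-ev {xs = tabulate (encodeRow G)} {[]} (subst (_< N) (sym (length-tabulate (encodeRow G))) k<N)
      (resp (list≡toTree (encodeRow G)) sev) nil-ev)

  solve : Equivalence G₁ G₂ → 0 < n → {v : Vector Tree n} → ⟦ head ⟧₁ (encodeMatrix G₁) ≡ list v → Solution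
  solve E 0<n {v} head≡ = conclude (start columns↓ (subst (0 <_) (sym length-columns↓) 0<n) (initial-invariant E))
    where
    input : Tree
    input = encodePair G₁ G₂

    start : ∀ T → 0 < length T → Invariant T columns↓ [] [] →
      Finished input T columns↓ [] [] (map index columns↓)
    start (i ∷ T) _ I = stages-loop input i T columns↓ [] [] (map index columns↓) I
      (trans (length-map index columns↓) (trans length-columns↓ (sym (*-identityʳ n))))

    queries≤n² : length columns↓ * n + 0 ≤ n ^ 2
    queries≤n² = ≤-reflexive (trans (+-identityʳ (length columns↓ * n))
      (cong₂ _*_ length-columns↓ (sym (*-identityʳ n))))

    columns≤N : length columns↓ ≤ N ^ 1
    columns≤N = subst₂ _≤_ (sym length-columns↓) (sym (^-identityʳ N)) (<⇒≤ n<N)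

    solution : ∀ π → Σ[ v ∈ Vector F* n ] image (π , v) ⟨ G₁ ⟩ ≐ ⟨ G₂ ⟩ →
      Evaluates (input ∷ᵛ []ᵛ) searchPermutation (encodePermutation π) exponent (n ^ 2) → Solution
    solution π isometry (evaluation c Q run c≤ l i) =
      π , c , Q , run , isometry , ≤-trans c≤ (≤-reflexive (sym (*-identityˡ (N ^ exponent)))) , l , i

    conclude : Finished input columns↓ columns↓ [] [] (map index columns↓) → Solution
    conclude (finished I loops) = solution (proj₁ (found I)) (assembled-isometry I)
      -- The stages have exponent 45, their iteration 46 and the whole loop 48; each of the four
      -- nested `let′` adds one, which gives 52.
      (weaken-queries queries≤n² (weaken 52≤exponent
        (let-ev (reversedRows-ev G₁ (straight (hd v₀)))
        (let-ev (reversedRows-ev G₂ (straight (tl (var 1F))))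
        (let-ev (descendingIndices-ev {v = v} n<N (resp head≡ (straight (hd (hd (var 2F))))))
        (let-ev (loop-ev 1 (straight (v₀ ∙′ v₀ ∙′ nil′ ∙′ nil′ ∙′ nil′ ∙′ nil′ ∙′ v₀)) loops columns≤N)
          (resp (output≡ I) (straight (hd (unused v₀) ∙′ images v₀)))))))))


-- Sizes of encoded instances

module Encoding (F : FiniteField) where
  open Semantics F

  size-list : ∀ {n} (v : Vector Tree n) → n < size (list v)
  size-list {zero}  v = s≤s z≤n
  size-list {suc n} v = s≤s (≤-trans (size-list (v ∘ suc)) (m≤n+m (size (list (v ∘ suc))) (size (v zero))))

  size-rows : ∀ {k n} (G : Matrix k n) → k < size (encodeMatrix G)
  size-rows G = size-list (λ r → list (λ j → atom (G r j)))

  size-columns : ∀ {k n} (G : Matrix k n) → 0 < k → n < size (encodeMatrix G)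
  size-columns {suc k} G _ = ≤-trans (size-list (λ j → atom (G zero j))) (m≤n⇒m≤1+n (m≤m+n _ _))

  head-row : ∀ {k n} (G : Matrix k n) → 0 < k → Σ[ v ∈ Vector Tree n ] ⟦ head ⟧₁ (encodeMatrix G) ≡ list v
  head-row {suc k} G _ = (λ j → atom (G zero j)) , refl

  -- The minimum weight is attained at a nonzero codeword, which excludes k = 0 and n = 0. With k
  -- positive there is a first row, from which the program obtains n and through which the input
  -- size exceeds n.
  code-positive : ∀ {n k d} (G : Matrix k n) → Is[ n , k , d ]Code ⟨ G ⟩ → 0 < k × 0 < n
  code-positive {k = zero}  G (_ , (x , (a , x≈0) , (i , xᵢ≉0) , _) , _) = ⊥-elim (xᵢ≉0 (x≈0 i))
  code-positive {k = suc k} G (_ , (_ , _ , (i , _) , _) , _) = s≤s z≤n , ≤-<-trans z≤n (Fin.toℕ<n i)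

  module _ {k n} (G H : Matrix k n) (0<k : 0 < k) where

    size₁≤size : size (encodeMatrix G) ≤ size (encodePair G H)
    size₁≤size = m≤n⇒m≤1+n (m≤m+n (size (encodeMatrix G)) (size (encodeMatrix H)))

    3≤size : 3 ≤ size (encodePair G H)
    3≤size = s≤s (+-mono-≤ (≤-trans (s≤s z≤n) (size-rows G)) (≤-trans (s≤s z≤n) (size-rows H)))

    rows<size : k < size (encodePair G H)
    rows<size = ≤-trans (size-rows G) size₁≤size

    columns<size : n < size (encodePair G H)
    columns<size = ≤-trans (size-columns G 0<k) size₁≤size

theorem2 : Σ[ P ∈ Program ] Σ[ a ∈ ℕ ] Σ[ e ∈ ℕ ]
    ((F : FiniteField) → let open Semantics F in
    (O : Oracle) → DecidesLCE O →
    ∀ {n k d} (G₁ G₂ : Matrix k n) →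
    Is[ n , k , d ]Code ⟨ G₁ ⟩ → Is[ n , k , d ]Code ⟨ G₂ ⟩ →
    LinearlyEquivalent ⟨ G₁ ⟩ ⟨ G₂ ⟩ →
    Σ[ π ∈ Permutation′ n ] Σ[ c ∈ ℕ ] Σ[ Q ∈ List Tree ]
    Runs O P (encodePair G₁ G₂) (encodePermutation π) c Q
    × (Σ[ v ∈ Vector F* n ] image (π , v) ⟨ G₁ ⟩ ≐ ⟨ G₂ ⟩)
    × c ≤ a * size (encodePair G₁ G₂) ^ e
    × length Q ≤ n ^ 2
    × All (IsLCEInstance k (n ^ 2 * (n + 1) / 2)) Q)
theorem2 = searchPermutation , 1 , exponent , λ F O decides {n} {k} G₁ G₂ code₁ code₂ equivalent →
  let open Encoding F
      0<k , 0<n = code-positive G₁ code₁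
      v , head≡ = head-row G₁ 0<k
  in Search.solve F O decides G₁ G₂ (proj₁ code₁) (proj₁ code₂) (Semantics.size F (Semantics.encodePair F G₁ G₂))
       (3≤size G₁ G₂ 0<k) (columns<size G₁ G₂ 0<k) (rows<size G₁ G₂ 0<k)
       (CodeProperties.fromLinearlyEquivalent F G₁ G₂ equivalent) 0<n head≡
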